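{- Let $t$ and $p$ be positive integers, and write $t=pn+d$ with integers $n\geq 0$ and $1\leq d\leq p$. Then the largest size of a $(t,t+1,\ldots,t+p)$-core partition is \[ \max\Big\{\tbinom{n+2}{2}\lfloor\tfrac{d}{2}\rfloor\big(d-\lfloor\tfrac{d}{2}\rfloor\big)+\tbinom{n+2}{3}(p^2n+pd-p^2)-3\tbinom{n+2}{4}p^2,\; \tbinom{n+1}{2}\big(p-\lfloor\tfrac{p-d}{2}\rfloor\big)\big(d+\lfloor\tfrac{p-d}{2}\rfloor\big)+\tbinom{n+1}{3}(p^2n+pd-p^2)-3\tbinom{n+1}{4}p^2\Big\}. \] Moreover, the number of $(t,t+1,\ldots,t+p)$-core partitions attaining this largest size is at most $4$.
   Context: A partition is a finite weakly decreasing sequence $\lambda=(\lambda_1,\ldots,\lambda_r)$ of positive integers (the empty partition is allowed); its size is $|\lambda|=\sum_i\lambda_i$. In the Young diagram of $\lambda$ (row $i$ has $\lambda_i$ left-justified boxes), the hook length $h(i,j)$ of box $(i,j)$ is the number of boxes directly to its right, directly below it, plus the box itself. For a positive integer $t$, $\lambda$ is a $t$-core partition if none of its hook lengths is divisible by $t$; it is a $(t_1,\ldots,t_m)$-core partition if it is a $t_i$-core for every $i$. Binomial coefficients $\binom{a}{b}$ are $0$ when $a<b$; $\lfloor x\rfloor$ is the floor of $x$. -}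

module Defs where

open import Data.Nat using (ℕ; zero; suc; _+_; _∸_; _≤_; _<_; _≥_; _≤ᵇ_)
open import Data.Nat.Divisibility using (_∣_)
open import Data.Bool using (if_then_else_)
open import Data.List using (List; []; _∷_; map; upTo)
open import Data.Nat.ListAction using (sum)
open import Data.Nat.DivMod using (_/_)
open import Data.Nat.Combinatorics using (_C_)
open import Data.Integer as ℤ using (ℤ; +_)
open import Data.List.Relation.Unary.All using (All)
open import Data.List.Relation.Unary.Linked using (Linked)
open import Relation.Nullary using (¬_)

IsPartition : List ℕ → Set
IsPartition λs = All (λ x → 1 ≤ x) λs × Linked _≥_ λs
  where open import Data.Product using (_×_)

size : List ℕ → ℕ
size = sum

-- length of column j (1-indexed): number of rows i with λ_i ≥ j
colLen : List ℕ → ℕ → ℕ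
colLen [] j = 0
colLen (x ∷ xs) j = if j ≤ᵇ x then suc (colLen xs j) else colLen xs j

-- hook lengths of the boxes of row i (1-indexed) of length r in diagram λ:
-- h(i,j) = (λ_i - j) + (λ'_j - i) + 1, for j = 1 .. r
rowHooks : List ℕ → ℕ → ℕ → List ℕ
rowHooks λs i r = map (λ k → (r ∸ suc k) + (colLen λs (suc k) ∸ i) + 1) (upTo r)

hooksFrom : List ℕ → ℕ → List ℕ → List ℕ
hooksFrom λs i [] = []
hooksFrom λs i (r ∷ rs) = rowHooks λs i r Data.List.++ hooksFrom λs (suc i) rs

hooks : List ℕ → List ℕ
hooks λs = hooksFrom λs 1 λs

IsCore : ℕ → List ℕ → Set
IsCore t λs = All (λ h → ¬ (t ∣ h)) (hooks λs)

IsMultiCore : ℕ → ℕ → List ℕ → Set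
IsMultiCore t p λs = IsPartition λs × (∀ k → k ≤ p → IsCore (t + k) λs)
  where open import Data.Product using (_×_)

-- the closed-form value from the theorem (computed in ℤ since intermediate
-- terms such as p²n + pd − p² can be negative)
formulaA : ℕ → ℕ → ℕ → ℤ
formulaA p n d =
  (+ ((n + 2) C 2)) ℤ.* (+ (d / 2)) ℤ.* (+ d ℤ.- + (d / 2))
  ℤ.+ (+ ((n + 2) C 3)) ℤ.* (+ p ℤ.* + p ℤ.* + n ℤ.+ + p ℤ.* + d ℤ.- + p ℤ.* + p)
  ℤ.- + 3 ℤ.* (+ ((n + 2) C 4)) ℤ.* (+ p ℤ.* + p)

formulaB : ℕ → ℕ → ℕ → ℤ
formulaB p n d =
  (+ ((n + 1) C 2)) ℤ.* (+ p ℤ.- + ((p ∸ d) / 2)) ℤ.* (+ d ℤ.+ + ((p ∸ d) / 2))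
  ℤ.+ (+ ((n + 1) C 3)) ℤ.* (+ p ℤ.* + p ℤ.* + n ℤ.+ + p ℤ.* + d ℤ.- + p ℤ.* + p)
  ℤ.- + 3 ℤ.* (+ ((n + 1) C 4)) ℤ.* (+ p ℤ.* + p)

largestSize : ℕ → ℕ → ℕ → ℤ
largestSize p n d = formulaA p n d ℤ.⊔ formulaB p n d

{-# OPTIONS --safe #-}
-- Encode a partition by its set S of first-column hook lengths.  It is a (t, …, t + p)-core iff 0 ∉ S and
-- S is closed under subtracting t, …, t + p.  Cut S into the windows [kt, (k + 1)t) and let a_k be the
-- number of elements in window k.  Closure forces a_{k-1} ≥ a_k + p as long as a_k > 0, and the number
-- m of nonempty windows is at most n + 1.  For given a_k the size is largest, and then
--   2 · size = 2t Σ (k + 1) a_k − Σ a_k² − (Σ a_k)²,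
-- exactly when each window consists of its a_k largest numbers.
--
-- Write t + p = 2x + ε + pm with ε ∈ {0, 1} and a_k = x + (m − 1 − k)p + y_k.  The right-hand side becomes
-- a constant V_m minus the defect
--   Σ y_k² + (Σ y_k)² − ε(m + 1) Σ y_k + (t + p) Σ_{i<j} (y_i − y_j),
-- where y is weakly decreasing in k.  The defect is nonnegative on integer sequences, and vanishes only
-- if all y_k are 0 or all are ε.  Since V_0 < V_1 < … < V_n, the maximum is max (V_n, V_{n+1}) / 2, the
-- two terms of the formula, and there are at most two maximizers for each of m = n and m = n + 1.
module Submission where

open import Defs
open import Data.Bool using (true; false)
open import Data.List using (List; []; _∷_; _++_; map; length)
open import Data.List.Properties using (length-++; length-map; ++-assoc; ∷-injectiveˡ; ∷-injectiveʳ)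
open import Data.List.Membership.Propositional using (_∈_; _∉_)
open import Data.List.Membership.Propositional.Properties using (∈-++⁺ˡ; ∈-++⁺ʳ; ∈-++⁻; ∈-∃++; ∈-map⁻)
open import Data.List.Relation.Unary.All as All using (All; []; _∷_)
import Data.List.Relation.Unary.All.Properties as All
open import Data.List.Relation.Unary.AllPairs as AllPairs using (AllPairs; []; _∷_)
import Data.List.Relation.Unary.AllPairs.Properties as AllPairs
open import Data.List.Relation.Unary.Any using (here; there)
open import Data.List.Relation.Unary.Linked using (Linked; []; [-]; _∷_)
open import Data.List.Relation.Unary.Linked.Properties using (Linked⇒AllPairs)
open import Data.List.Relation.Unary.Unique.Propositional using (Unique)
import Data.List.Relation.Unary.Unique.Propositional.Properties as Unique
open import Data.Nat.Combinatorics using (_C_; nCk+nC[k+1]≡[n+1]C[k+1]; nC1≡n)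
open import Data.Nat.ListAction using (sum)
open import Data.Nat.ListAction.Properties using (sum-++)
open import Data.Product using (_×_; _,_; proj₁; proj₂; ∃-syntax)
open import Data.Sum using (_⊎_; inj₁; inj₂; [_,_]′)
open import Data.Unit using (⊤; tt)
open import Relation.Binary.Definitions using (tri<; tri≈; tri>)
open import Relation.Binary.PropositionalEquality
open import Relation.Nullary using (yes; no; contradiction)

-- A quadratic form on integer sequences

module QuadraticForm where

  open import Data.Integer using (ℤ; +_; -[1+_]; 0ℤ; 1ℤ; _+_; _*_; _-_; -_; _≤_; _<_; +≤+)
  open import Data.Integer.Properties
  open import Data.Integer.Tactic.RingSolver using (solve-∀)
  open import Data.Nat using (ℕ; zero; suc; z≤n; s≤s)

  -- spread as = Σ_{i<j} (a_j − a_i)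
  total squares weighted spread : List ℤ → ℤ
  total [] = 0ℤ
  total (a ∷ as) = a + total as
  squares [] = 0ℤ
  squares (a ∷ as) = a * a + squares as
  weighted [] = 0ℤ
  weighted (a ∷ as) = + suc (length as) * a + weighted as
  spread [] = 0ℤ
  spread (a ∷ as) = (total as - + length as * a) + spread as

  excess : ℤ → ℤ → List ℤ → List ℤ
  excess p x [] = []
  excess p x (a ∷ as) = a - x ∷ excess p (x + p) as

  -- The part of `value` free of `x` and `ε`. Its increments are what removing the top window in
  -- `identity` leaves over besides the terms in `x * (x + ε)`.
  base : ℤ → ℤ → ℕ → ℤ
  base t p zero = 0ℤ
  base t p (suc m) = base t p m + + m * (1ℤ + + m) * (p * (t - p * + m))

  -- Twice the size of the core whose windows contain, from the top down, x, x + p, …, x + (m − 1)p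
  -- elements, provided that t + p = 2x + ε + pm.
  value : ℤ → ℤ → ℕ → ℤ → ℤ → ℤ
  value t p m x ε = + m * (1ℤ + + m) * (x * (x + ε)) + base t p m

  length-excess : ∀ p x as → length (excess p x as) ≡ length as
  length-excess p x [] = refl
  length-excess p x (a ∷ as) = cong suc (length-excess p (x + p) as)

  -- The subtracted progression sums to `m * x` plus `p` times a triangular number; doubling avoids
  -- the division by 2.
  2total : ∀ p x as → let m = + length as in
    + 2 * total as ≡ + 2 * total (excess p x as) + + 2 * m * x + p * m * (m - 1ℤ)
  2total p x [] = lem x p where
    lem : ∀ x p → + 2 * 0ℤ ≡ + 2 * 0ℤ + + 2 * 0ℤ * x + p * 0ℤ * (0ℤ - 1ℤ)
    lem = solve-∀
  2total p x (a ∷ as) = begin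
    + 2 * (a + total as) ≡⟨ l1 a (total as) ⟩
    + 2 * a + + 2 * total as ≡⟨ cong (λ k → + 2 * a + k) (2total p (x + p) as) ⟩
    _ ≡⟨ l2 a x p (+ length as) (total (excess p (x + p) as)) ⟩
    _ ∎
    where
    open ≡-Reasoning
    l1 : ∀ a T → + 2 * (a + T) ≡ + 2 * a + + 2 * T
    l1 = solve-∀
    l2 : ∀ a x p m Y → + 2 * a + (+ 2 * Y + + 2 * m * (x + p) + p * m * (m - 1ℤ))
      ≡ + 2 * (a - x + Y) + + 2 * (1ℤ + m) * x + p * (1ℤ + m) * (1ℤ + m - 1ℤ)
    l2 = solve-∀

  defect : ℤ → ℤ → ℤ → List ℤ → ℤ
  defect t p ε ys = squares ys + total ys * total ys - ε * (1ℤ + + length ys) * total ys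
                  + (t + p) * spread ys

  -- Induction removes the top window: as 2x + ε + p(m + 1) = 2(x + p) + (ε - p) + pm, the tail
  -- satisfies the same relation with `x + p` and `ε - p`. Hence `ε` must range over all integers
  -- here and not only over 0 and 1.
  identity : ∀ {t p} x ε as → t + p ≡ + 2 * x + ε + p * + length as →
    + 2 * t * weighted as + defect t p ε (excess p x as)
      ≡ value t p (length as) x ε + squares as + total as * total as
  identity {t} {p} x ε [] _ = lem t p x ε where
    lem : ∀ t p x ε → + 2 * t * 0ℤ + (0ℤ + 0ℤ * 0ℤ - ε * (1ℤ + 0ℤ) * 0ℤ + (t + p) * 0ℤ)
       ≡ 0ℤ * (1ℤ + 0ℤ) * (x * (x + ε)) + 0ℤ + 0ℤ + 0ℤ * 0ℤ
    lem = solve-∀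
  identity {t} {p} x ε (a ∷ as) eq
    rewrite length-excess p (x + p) as = begin
    _ ≡⟨ step t p x ε (+ length as) a (weighted as) S Y P ⟩
    (+ 2 * t * weighted as + (S + Y * Y - (ε - p) * (1ℤ + + length as) * Y + (t + p) * P)) + extra t
      -- By hypothesis `t` is determined by `x`, `ε`, `p` and `m`. It is eliminated from `extra`
      -- first; afterwards 2x + ε is turned back into t - pm, the form that occurs in `base`.
      ≡⟨ cong₂ _+_ ih (trans (cong extra t≡) (rest x ε p (+ length as) a Y)) ⟩
    (value t p (length as) (x + p) (ε - p) + squares as + total as * total as)
     + (main (+ 2 * x + ε) + a * a + a * a
         + a * (+ 2 * Y + + 2 * + length as * (x + p) + p * + length as * (+ length as - 1ℤ)))
      ≡⟨ cong₂ (λ u v → value t p (length as) (x + p) (ε - p) + squares as + total as * total as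
          + (main u + a * a + a * a + a * v)) (sym d≡) (sym (2total p (x + p) as)) ⟩
    _ ≡⟨ fin t p x ε (+ length as) a (base t p (length as)) (squares as) (total as) ⟩
    _ ∎
    where
    open ≡-Reasoning
    S Y P : ℤ
    S = squares (excess p (x + p) as)
    Y = total (excess p (x + p) as)
    P = spread (excess p (x + p) as)
    m = + length as
    extra main : ℤ → ℤ
    extra t = + 2 * t * (1ℤ + m) * a + (a - x) * (a - x) + (a - x) * (a - x) + + 2 * (a - x) * Y
      - ε * (+ 2 + m) * (a - x + Y) + (ε - p) * (1ℤ + m) * Y + (t + p) * (Y - m * (a - x))
    main d = (1ℤ + m) * (+ 2 + m) * (x * (x + ε)) - m * (1ℤ + m) * ((x + p) * (x + ε))
      + m * (1ℤ + m) * (p * d)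
    cancel : ∀ a b → a ≡ a + b - b
    cancel = solve-∀
    t≡ : t ≡ + 2 * x + ε + p * m
    t≡ = trans (cancel t p) (trans (cong (_- p) eq) (l x ε p m)) where
      l : ∀ x ε p m → + 2 * x + ε + p * (1ℤ + m) - p ≡ + 2 * x + ε + p * m
      l = solve-∀
    d≡ : t - p * m ≡ + 2 * x + ε
    d≡ = trans (cong (_- p * m) t≡) (sym (cancel (+ 2 * x + ε) (p * m)))
    ih : + 2 * t * weighted as + (S + Y * Y - (ε - p) * (1ℤ + m) * Y + (t + p) * P)
       ≡ value t p (length as) (x + p) (ε - p) + squares as + total as * total as
    ih = trans (cong (λ k → + 2 * t * weighted as + (S + Y * Y - (ε - p) * (1ℤ + + k) * Y + (t + p) * P))
             (sym (length-excess p (x + p) as)))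
           (identity (x + p) (ε - p) as (trans eq (l x ε p m)))
      where
      l : ∀ x ε p m → + 2 * x + ε + p * (1ℤ + m) ≡ + 2 * (x + p) + (ε - p) + p * m
      l = solve-∀
    step : ∀ t p x ε m a W S Y P →
      + 2 * t * ((1ℤ + m) * a + W)
        + (((a - x) * (a - x) + S) + (a - x + Y) * (a - x + Y) - ε * (1ℤ + (1ℤ + m)) * (a - x + Y)
        + (t + p) * ((Y - m * (a - x)) + P))
      ≡ (+ 2 * t * W + (S + Y * Y - (ε - p) * (1ℤ + m) * Y + (t + p) * P)) +
        (+ 2 * t * (1ℤ + m) * a + (a - x) * (a - x) + (a - x) * (a - x) + + 2 * (a - x) * Y
      - ε * (+ 2 + m) * (a - x + Y) + (ε - p) * (1ℤ + m) * Y + (t + p) * (Y - m * (a - x)))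
    step = solve-∀
    rest : ∀ x ε p m a Y →
       + 2 * (+ 2 * x + ε + p * m) * (1ℤ + m) * a + (a - x) * (a - x) + (a - x) * (a - x) + + 2 * (a - x) * Y
      - ε * (+ 2 + m) * (a - x + Y) + (ε - p) * (1ℤ + m) * Y + ((+ 2 * x + ε + p * m) + p) * (Y - m * (a - x))
      ≡ ((1ℤ + m) * (+ 2 + m) * (x * (x + ε)) - m * (1ℤ + m) * ((x + p) * (x + ε))
          + m * (1ℤ + m) * (p * (+ 2 * x + ε)))
       + a * a + a * a + a * (+ 2 * Y + + 2 * m * (x + p) + p * m * (m - 1ℤ))
    rest = solve-∀
    fin : ∀ t p x ε m a K S A →
      (m * (1ℤ + m) * ((x + p) * (x + p + (ε - p))) + K + S + A * A) +
      (((1ℤ + m) * (+ 2 + m) * (x * (x + ε)) - m * (1ℤ + m) * ((x + p) * (x + ε))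
          + m * (1ℤ + m) * (p * (t - p * m)))
        + a * a + a * a + a * (+ 2 * A))
      ≡ (1ℤ + m) * (1ℤ + (1ℤ + m)) * (x * (x + ε)) + (K + m * (1ℤ + m) * (p * (t - p * m)))
        + (a * a + S) + (a + A) * (a + A)
    fin = solve-∀

  -- Nonnegativity and zeros of the defect

  0≤+ : ∀ {i j} → 0ℤ ≤ i → 0ℤ ≤ j → 0ℤ ≤ i + j
  0≤+ = +-mono-≤

  0≤* : ∀ {i j} → 0ℤ ≤ i → 0ℤ ≤ j → 0ℤ ≤ i * j
  0≤* {+ m} {+ n} _ _ = subst (0ℤ ≤_) (pos-* m n) (+≤+ z≤n)

  0≤square : ∀ i → 0ℤ ≤ i * i
  0≤square (+ n) = 0≤* {+ n} {+ n} (+≤+ z≤n) (+≤+ z≤n)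
  0≤square -[1+ n ] = +≤+ z≤n

  0≤i+j≤0⇒i≡0 : ∀ {i j} → 0ℤ ≤ i → 0ℤ ≤ j → i + j ≤ 0ℤ → i ≡ 0ℤ
  0≤i+j≤0⇒i≡0 {i} {j} 0≤i 0≤j i+j≤0 = ≤-antisym
    (≤-trans (subst (_≤ i + j) (+-identityʳ i) (+-monoʳ-≤ i 0≤j)) i+j≤0) 0≤i

  0≤i+j≤0⇒j≡0 : ∀ {i j} → 0ℤ ≤ i → 0ℤ ≤ j → i + j ≤ 0ℤ → j ≡ 0ℤ
  0≤i+j≤0⇒j≡0 {i} {j} 0≤i 0≤j i+j≤0 = 0≤i+j≤0⇒i≡0 0≤j 0≤i (subst (_≤ 0ℤ) (+-comm i j) i+j≤0)

  IsBit : ℤ → Set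
  IsBit ε = ε ≡ 0ℤ ⊎ ε ≡ 1ℤ

  -- The product is negative only strictly between 0 and `ε`, where there is no integer.
  0≤y²-εy : ∀ {ε} → IsBit ε → ∀ y → 0ℤ ≤ y * (y - ε)
  0≤y²-εy (inj₁ refl) y = subst (λ z → 0ℤ ≤ y * z) (sym (+-identityʳ y)) (0≤square y)
  0≤y²-εy (inj₂ refl) (+ zero) = +≤+ z≤n
  0≤y²-εy (inj₂ refl) (+ suc n) = 0≤* {+ suc n} {+ n} (+≤+ z≤n) (+≤+ z≤n)
  0≤y²-εy (inj₂ refl) -[1+ n ] = +≤+ z≤n

  y²-εy≡0⇒y∈0,ε : ∀ ε y → y * (y - ε) ≡ 0ℤ → y ≡ 0ℤ ⊎ y ≡ ε
  y²-εy≡0⇒y∈0,ε ε y eq with i*j≡0⇒i≡0∨j≡0 y eq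
  ... | inj₁ y≡0 = inj₁ y≡0
  ... | inj₂ y-ε≡0 = inj₂ (i-j≡0⇒i≡j y ε y-ε≡0)

  Sorted : List ℤ → Set
  Sorted = AllPairs _≤_

  length*≤total : ∀ {y ys} → All (y ≤_) ys → 0ℤ ≤ total ys - + length ys * y
  length*≤total [] = +≤+ z≤n
  length*≤total {y} {z ∷ ys} (y≤z ∷ y≤ys) = subst (0ℤ ≤_) (lem y z (total ys) (+ length ys))
      (0≤+ (i≤j⇒0≤j-i y≤z) (length*≤total y≤ys))
    where
    lem : ∀ y z T m → (z - y) + (T - m * y) ≡ z + T - (1ℤ + m) * y
    lem = solve-∀

  length*≡total⇒constant : ∀ {y ys} → All (y ≤_) ys → total ys - + length ys * y ≡ 0ℤ → All (_≡ y) ys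
  length*≡total⇒constant [] _ = []
  length*≡total⇒constant {y} {z ∷ ys} (y≤z ∷ y≤ys) eq =
      i-j≡0⇒i≡j z y (0≤i+j≤0⇒i≡0 0≤h 0≤t sum≤0) ∷ length*≡total⇒constant y≤ys (0≤i+j≤0⇒j≡0 0≤h 0≤t sum≤0)
    where
    lem : ∀ y z T m → (z - y) + (T - m * y) ≡ z + T - (1ℤ + m) * y
    lem = solve-∀
    0≤h = i≤j⇒0≤j-i y≤z
    0≤t = length*≤total y≤ys
    sum≤0 : (z - y) + (total ys - + length ys * y) ≤ 0ℤ
    sum≤0 = ≤-reflexive (trans (lem y z (total ys) (+ length ys)) eq)

  0≤spread : ∀ {ys} → Sorted ys → 0ℤ ≤ spread ys
  0≤spread [] = +≤+ z≤n
  0≤spread (y≤ys ∷ s) = 0≤+ (length*≤total y≤ys) (0≤spread s)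

  -- b and Z count and sum the entries ≤ 0 of ys, g and X those ≥ 1.
  record SignSplit (ys : List ℤ) : Set where
    field
      b g Z X : ℤ
      0≤b : 0ℤ ≤ b
      0≤g : 0ℤ ≤ g
      length≡ : + length ys ≡ b + g
      total≡ : total ys ≡ Z + X
      0≤-Z : 0ℤ ≤ - Z
      0≤X-g : 0ℤ ≤ X - g
      0≤Z-by : ∀ {y} → All (y ≤_) ys → 0ℤ ≤ Z - b * y
      spread≥ : 0ℤ ≤ spread ys - (b * X - g * Z)

  -- In `spread≥`, bX - gZ is the sum of the differences over the pairs of an entry ≤ 0 and an entry
  -- ≥ 1; in a sorted list the remaining pairs contribute nonnegatively. If the head is positive, so
  -- is everything after it. If not, its pairs with the later entries ≤ 0 contribute Z - by, which
  -- is why `0≤Z-by` is carried along.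
  signSplit : ∀ {ys} → Sorted ys → SignSplit ys
  signSplit [] = record
    { b = 0ℤ ; g = 0ℤ ; Z = 0ℤ ; X = 0ℤ ; 0≤b = ≤-refl ; 0≤g = ≤-refl ; length≡ = refl ; total≡ = refl
    ; 0≤-Z = ≤-refl ; 0≤X-g = ≤-refl ; 0≤Z-by = λ _ → ≤-refl ; spread≥ = ≤-refl }
  signSplit {y ∷ ys} (y≤ys ∷ s) with 1ℤ ≤? y
  ... | yes 1≤y = record
    { b = 0ℤ ; g = + suc (length ys) ; Z = 0ℤ ; X = y + total ys ; 0≤b = ≤-refl ; 0≤g = +≤+ z≤n
    ; length≡ = refl ; total≡ = sym (+-identityˡ _) ; 0≤-Z = ≤-refl
    ; 0≤X-g = subst (λ k → 0ℤ ≤ y + total ys - k) (*-identityʳ _)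
        (length*≤total {1ℤ} (1≤y ∷ All.map (≤-trans 1≤y) y≤ys))
    ; 0≤Z-by = λ _ → ≤-refl
    ; spread≥ = subst (0ℤ ≤_) (lem (spread (y ∷ ys)) (y + total ys) (+ suc (length ys))) (0≤spread (y≤ys ∷ s)) }
    where
    lem : ∀ P X g → P ≡ P - (0ℤ * X - g * 0ℤ)
    lem = solve-∀
  ... | no 1≰y = record
    { b = 1ℤ + b ; g = g ; Z = y + Z ; X = X ; 0≤b = 0≤+ (+≤+ z≤n) 0≤b ; 0≤g = 0≤g
    ; length≡ = trans (cong (λ k → 1ℤ + k) length≡) (sym (+-assoc 1ℤ b g))
    ; total≡ = trans (cong (λ k → y + k) total≡) (sym (+-assoc y Z X))
    ; 0≤-Z = subst (0ℤ ≤_) (sym (neg-distrib-+ y Z)) (0≤+ (neg-mono-≤ y≤0) 0≤-Z)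
    ; 0≤X-g = 0≤X-g
    ; 0≤Z-by = λ { {y'} (y'≤y ∷ y'≤ys) → subst (0ℤ ≤_) (l1 y' y Z b)
        (0≤+ (i≤j⇒0≤j-i y'≤y) (0≤Z-by y'≤ys)) }
    ; spread≥ = subst (0ℤ ≤_) (trans (l2 (spread ys) b g X Z y)
        (cong₂ (λ T m → (T - m * y) + spread ys - ((1ℤ + b) * X - g * (y + Z))) (sym total≡) (sym length≡)))
        (0≤+ spread≥ (0≤Z-by y≤ys)) }
    where
    open SignSplit (signSplit s)
    y≤0 : y ≤ 0ℤ
    y≤0 = i<j⇒i≤pred[j] (≰⇒> 1≰y)
    l1 : ∀ y' y Z b → (y - y') + (Z - b * y') ≡ y + Z - (1ℤ + b) * y'
    l1 = solve-∀
    l2 : ∀ P b g X Z y → (P - (b * X - g * Z)) + (Z - b * y)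
       ≡ (Z + X - (b + g) * y) + P - ((1ℤ + b) * X - g * (y + Z))
    l2 = solve-∀

  -- Y(Y - m) is negative for 0 < Y < m, and the spread has to compensate. The pairs of opposite
  -- kind suffice: Y(Y - m) + (bX - gZ) = (Y - g)² + g(X - g) - bZ, with no negative term on the
  -- right.
  0≤Y²-mY+spread : ∀ {ys} → Sorted ys → 0ℤ ≤ total ys * (total ys - + length ys) + spread ys
  0≤Y²-mY+spread {ys} s = subst (0ℤ ≤_)
      (trans (lem (spread ys) b g X Z)
        (cong₂ (λ T m → T * (T - m) + spread ys) (sym total≡) (sym length≡)))
      (0≤+ (0≤+ (0≤+ spread≥ (0≤square (X + Z - g))) (0≤* 0≤g 0≤X-g)) (0≤* 0≤b 0≤-Z))
    where
    open SignSplit (signSplit s)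
    lem : ∀ P b g X Z → (P - (b * X - g * Z)) + (X + Z - g) * (X + Z - g) + g * (X - g) + b * (- Z)
      ≡ (Z + X) * (Z + X - (b + g)) + P
    lem = solve-∀

  0≤Y²-εmY+spread : ∀ {ε ys} → IsBit ε → Sorted ys →
    0ℤ ≤ total ys * (total ys - ε * + length ys) + spread ys
  0≤Y²-εmY+spread {ys = ys} (inj₁ refl) s =
    0≤+ (subst (λ k → 0ℤ ≤ total ys * k) (sym (+-identityʳ _)) (0≤square (total ys))) (0≤spread s)
  0≤Y²-εmY+spread {ys = ys} (inj₂ refl) s =
    subst (λ k → 0ℤ ≤ total ys * (total ys - k) + spread ys) (sym (*-identityˡ _)) (0≤Y²-mY+spread s)

  0≤squares-ε*total : ∀ {ε} → IsBit ε → ∀ ys → 0ℤ ≤ squares ys - ε * total ys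
  0≤squares-ε*total {ε} bit [] = ≤-reflexive (lem ε) where
    lem : ∀ ε → 0ℤ ≡ 0ℤ - ε * 0ℤ
    lem = solve-∀
  0≤squares-ε*total {ε} bit (y ∷ ys) = subst (0ℤ ≤_) (lem ε y (squares ys) (total ys))
    (0≤+ (0≤y²-εy bit y) (0≤squares-ε*total bit ys)) where
    lem : ∀ ε y S T → y * (y - ε) + (S - ε * T) ≡ y * y + S - ε * (y + T)
    lem = solve-∀

  module _ {t p ε : ℤ} (bit : IsBit ε) (2≤t+p : 0ℤ ≤ t + p - + 2) where

    -- One copy of the spread supports Y(Y - εm), and one is kept apart so that a vanishing defect
    -- forces a vanishing spread. This costs two copies, whence the assumption t + p ≥ 2.
    defect≡ : ∀ ys → let S = squares ys ; Y = total ys ; m = + length ys ; P = spread ys in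
      (S - ε * Y) + ((Y * (Y - ε * m) + P) + (t + p - + 2) * P) + P ≡ defect t p ε ys
    defect≡ ys = lem t p ε (squares ys) (total ys) (+ length ys) (spread ys) where
      lem : ∀ t p ε S Y m P → (S - ε * Y) + ((Y * (Y - ε * m) + P) + (t + p - + 2) * P) + P
        ≡ S + Y * Y - ε * (1ℤ + m) * Y + (t + p) * P
      lem = solve-∀

    0≤defect : ∀ {ys} → Sorted ys → 0ℤ ≤ defect t p ε ys
    0≤defect {ys} s = subst (0ℤ ≤_) (defect≡ ys)
      (0≤+ (0≤+ (0≤squares-ε*total bit ys)
           (0≤+ (0≤Y²-εmY+spread bit s) (0≤* 2≤t+p (0≤spread s)))) (0≤spread s))

    -- All the nonnegative summands vanish. Zero spread makes every entry equal to the head `y`, and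
    -- y(y - ε) = 0 leaves two choices for it.
    defect≤0⇒constant : ∀ {ys} → Sorted ys → defect t p ε ys ≤ 0ℤ → All (_≡ 0ℤ) ys ⊎ All (_≡ ε) ys
    defect≤0⇒constant [] _ = inj₁ []
    defect≤0⇒constant {y ∷ ys} s@(y≤ys ∷ s′) d≤0 =
        [ (λ y≡0 → inj₁ (y≡0 ∷ All.map (λ z≡y → trans z≡y y≡0) tail≡))
        , (λ y≡ε → inj₂ (y≡ε ∷ All.map (λ z≡y → trans z≡y y≡ε) tail≡)) ]′
        (y²-εy≡0⇒y∈0,ε ε y y²-εy≡0)
      where
      rest≥0 = 0≤+ (0≤Y²-εmY+spread bit s) (0≤* 2≤t+p (0≤spread s))
      front≥0 = 0≤+ (0≤squares-ε*total bit (y ∷ ys)) rest≥0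
      sum≤0 = subst (_≤ 0ℤ) (sym (defect≡ (y ∷ ys))) d≤0
      front≡0 = 0≤i+j≤0⇒i≡0 front≥0 (0≤spread s) sum≤0
      squares≡0 = 0≤i+j≤0⇒i≡0 (0≤squares-ε*total bit (y ∷ ys)) rest≥0 (≤-reflexive front≡0)
      lem : ∀ ε y S T → y * (y - ε) + (S - ε * T) ≡ y * y + S - ε * (y + T)
      lem = solve-∀
      y²-εy≡0 : y * (y - ε) ≡ 0ℤ
      y²-εy≡0 = 0≤i+j≤0⇒i≡0 (0≤y²-εy bit y) (0≤squares-ε*total bit ys)
        (≤-reflexive (trans (lem ε y (squares ys) (total ys)) squares≡0))
      spread≡0 : spread (y ∷ ys) ≡ 0ℤ
      spread≡0 = 0≤i+j≤0⇒j≡0 front≥0 (0≤spread s) sum≤0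
      tail≡ : All (_≡ y) ys
      tail≡ = length*≡total⇒constant y≤ys
        (0≤i+j≤0⇒i≡0 (length*≤total y≤ys) (0≤spread s′) (≤-reflexive spread≡0))

  -- Growth of the constants

  0≤1-ε² : ∀ {ε} → IsBit ε → 0ℤ ≤ 1ℤ - ε * ε
  0≤1-ε² (inj₁ refl) = +≤+ z≤n
  0≤1-ε² (inj₂ refl) = +≤+ z≤n

  -- With s = t − p(m + 1) one has 4x(x + ε) = (s + 2p)² − ε² and 4x′(x′ + ε′) = (s + p)² − ε′², so four
  -- times the difference is (m + 1)((m + 2)((s + p)² − ε′²) − m(s² − ε²)), which is positive as p, s ≥ 1.
  value-< : ∀ {t p ε ε′} m x x′ → IsBit ε → IsBit ε′ → 0ℤ ≤ p - 1ℤ → 0ℤ ≤ t - p * + suc m - 1ℤ →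
    t + p ≡ + 2 * x + ε + p * + m → t + p ≡ + 2 * x′ + ε′ + p * + suc m →
    value t p m x ε < value t p (suc m) x′ ε′
  value-< {t} {p} {ε} {ε′} m x x′ bit bit′ 1≤p 1≤s eq eq′ =
      *-cancelˡ-<-nonNeg {value t p m x ε} {value t p (suc m) x′ ε′} (+ 4)
        (suc[i]≤j⇒i<j (0≤i-j⇒j≤i (subst (0ℤ ≤_) gap≡ (0≤+ (0≤* 0≤M 0≤Δ) 0≤Δ-1))))
    where
    M s u v Δ b : ℤ
    M = + m
    s = t - p * (1ℤ + M)
    u = s - 1ℤ
    v = p - 1ℤ
    Δ = (+ 2 + M) * ((s + p) * (s + p) - ε′ * ε′) - M * (s * s - ε * ε)
    b = base t p m
    0≤M : 0ℤ ≤ M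
    0≤M = +≤+ z≤n
    0≤u+v : 0ℤ ≤ u + v
    0≤u+v = 0≤+ 1≤s 1≤p
    -- With s = 1 + u and p = 1 + v, Δ - 1 becomes a sum of visibly nonnegative terms.
    expand : ∀ u v M ε ε′ →
      M * (+ 2 * ((1ℤ + u) * (1ℤ + v)) + v * (+ 2 + v)) + (+ 5 + + 8 * (u + v) + + 2 * ((u + v) * (u + v)))
        + (+ 2 + M) * (1ℤ - ε′ * ε′) + M * (ε * ε)
      ≡ (+ 2 + M) * (((1ℤ + u) + (1ℤ + v)) * ((1ℤ + u) + (1ℤ + v)) - ε′ * ε′)
        - M * ((1ℤ + u) * (1ℤ + u) - ε * ε) - 1ℤ
    expand = solve-∀
    1+i-1≡i : ∀ i → 1ℤ + (i - 1ℤ) ≡ i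
    1+i-1≡i = solve-∀
    0≤Δ-1 : 0ℤ ≤ Δ - 1ℤ
    0≤Δ-1 = subst (0ℤ ≤_)
      (trans (expand u v M ε ε′)
        (cong₂ (λ s p → (+ 2 + M) * ((s + p) * (s + p) - ε′ * ε′) - M * (s * s - ε * ε) - 1ℤ)
          (1+i-1≡i s) (1+i-1≡i p)))
      (0≤+ (0≤+ (0≤+
        (0≤* 0≤M (0≤+ (0≤* {+ 2} (+≤+ z≤n) (0≤* (0≤+ {1ℤ} (+≤+ z≤n) 1≤s) (0≤+ {1ℤ} (+≤+ z≤n) 1≤p)))
                      (0≤* 1≤p (0≤+ {+ 2} (+≤+ z≤n) 1≤p))))
        (0≤+ (0≤+ {+ 5} (+≤+ z≤n) (0≤* {+ 8} (+≤+ z≤n) 0≤u+v))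
             (0≤* {+ 2} (+≤+ z≤n) (0≤square (u + v)))))
        (0≤* (0≤+ {+ 2} (+≤+ z≤n) 0≤M) (0≤1-ε² bit′)))
        (0≤* 0≤M (0≤square ε)))
    0≤Δ : 0ℤ ≤ Δ
    0≤Δ = subst (0ℤ ≤_) (1+i-1≡i Δ) (0≤+ {1ℤ} (+≤+ z≤n) 0≤Δ-1)
    4sq : ∀ x ε → + 4 * (x * (x + ε)) ≡ (+ 2 * x + ε) * (+ 2 * x + ε) - ε * ε
    4sq = solve-∀
    i≡i+j-j : ∀ i j → i ≡ i + j - j
    i≡i+j-j = solve-∀
    2x+ε≡ : ∀ {k} x ε → t + p ≡ + 2 * x + ε + p * k → + 2 * x + ε ≡ t + p - p * k
    2x+ε≡ {k} x ε e = trans (i≡i+j-j (+ 2 * x + ε) (p * k)) (cong (_- p * k) (sym e))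
    4xx : + 4 * (x * (x + ε)) ≡ (t + p - p * M) * (t + p - p * M) - ε * ε
    4xx = trans (4sq x ε) (cong (λ k → k * k - ε * ε) (2x+ε≡ x ε eq))
    4xx′ : + 4 * (x′ * (x′ + ε′)) ≡ (t + p - p * (1ℤ + M)) * (t + p - p * (1ℤ + M)) - ε′ * ε′
    4xx′ = trans (4sq x′ ε′) (cong (λ k → k * k - ε′ * ε′) (2x+ε≡ x′ ε′ eq′))
    l1 : ∀ t p M ε ε′ b →
      M * ((+ 2 + M) * ((t - p * (1ℤ + M) + p) * (t - p * (1ℤ + M) + p) - ε′ * ε′)
          - M * ((t - p * (1ℤ + M)) * (t - p * (1ℤ + M)) - ε * ε))
        + ((+ 2 + M) * ((t - p * (1ℤ + M) + p) * (t - p * (1ℤ + M) + p) - ε′ * ε′)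
          - M * ((t - p * (1ℤ + M)) * (t - p * (1ℤ + M)) - ε * ε) - 1ℤ) ≡
      (1ℤ + M) * (1ℤ + (1ℤ + M)) * ((t + p - p * (1ℤ + M)) * (t + p - p * (1ℤ + M)) - ε′ * ε′)
        + + 4 * (b + M * (1ℤ + M) * (p * (t - p * M)))
        - (1ℤ + (M * (1ℤ + M) * ((t + p - p * M) * (t + p - p * M) - ε * ε) + + 4 * b))
    l1 = solve-∀
    l2 : ∀ M q b → M * (1ℤ + M) * (+ 4 * q) + + 4 * b ≡ + 4 * (M * (1ℤ + M) * q + b)
    l2 = solve-∀
    gap≡ : M * Δ + (Δ - 1ℤ) ≡ + 4 * value t p (suc m) x′ ε′ - (1ℤ + + 4 * value t p m x ε)
    gap≡ = begin
      M * Δ + (Δ - 1ℤ) ≡⟨ l1 t p M ε ε′ b ⟩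
      _ ≡⟨ cong₂ (λ q q′ → (1ℤ + M) * (1ℤ + (1ℤ + M)) * q + + 4 * base t p (suc m)
              - (1ℤ + (M * (1ℤ + M) * q′ + + 4 * b))) (sym 4xx′) (sym 4xx) ⟩
      _ ≡⟨ cong₂ (λ q q′ → q - (1ℤ + q′))
             (l2 (1ℤ + M) (x′ * (x′ + ε′)) (base t p (suc m))) (l2 M (x * (x + ε)) b) ⟩
      _ ∎
      where open ≡-Reasoning

  -- Zero excess, and the shortfall of a size from `value`

  total-zero : ∀ {ys} → All (_≡ 0ℤ) ys → total ys ≡ 0ℤ
  total-zero [] = refl
  total-zero (refl ∷ z) = trans (+-identityˡ _) (total-zero z)

  squares-zero : ∀ {ys} → All (_≡ 0ℤ) ys → squares ys ≡ 0ℤ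
  squares-zero [] = refl
  squares-zero (refl ∷ z) = trans (+-identityˡ _) (squares-zero z)

  spread-zero : ∀ {ys} → All (_≡ 0ℤ) ys → spread ys ≡ 0ℤ
  spread-zero [] = refl
  spread-zero {y ∷ ys} (refl ∷ z) =
      trans (cong₂ (λ u v → (u - + length ys * 0ℤ) + v) (total-zero z) (spread-zero z)) (lem (+ length ys))
    where
    lem : ∀ m → (0ℤ - m * 0ℤ) + 0ℤ ≡ 0ℤ
    lem = solve-∀

  defect-zero : ∀ t p ε {ys} → All (_≡ 0ℤ) ys → defect t p ε ys ≡ 0ℤ
  defect-zero t p ε {ys} z rewrite squares-zero z | total-zero z | spread-zero z = lem t p ε (+ length ys) where
    lem : ∀ t p ε m → 0ℤ + 0ℤ * 0ℤ - ε * (1ℤ + m) * 0ℤ + (t + p) * 0ℤ ≡ 0ℤ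
    lem = solve-∀

  -- For `s` the size of a core with window lengths `as`, the shortfall has two sources: the defect
  -- of the lengths, and the amount by which the windows fail to consist of their largest numbers.
  value-size : ∀ {t p} x ε as → t + p ≡ + 2 * x + ε + p * + length as → ∀ s →
    value t p (length as) x ε - + 2 * s ≡
      defect t p ε (excess p x as) + (+ 2 * t * weighted as - (+ 2 * s + total as * total as + squares as))
  value-size {t} {p} x ε as eq s = begin
    value t p (length as) x ε - + 2 * s
      ≡⟨ l1 (value t p (length as) x ε) s (squares as) (total as) ⟩
    (value t p (length as) x ε + squares as + total as * total as) - (+ 2 * s + total as * total as + squares as)
      ≡⟨ cong (_- (+ 2 * s + total as * total as + squares as)) (sym (identity x ε as eq)) ⟩
    (+ 2 * t * weighted as + defect t p ε (excess p x as)) - (+ 2 * s + total as * total as + squares as)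
      ≡⟨ l2 (+ 2 * t * weighted as) (defect t p ε (excess p x as)) (+ 2 * s + total as * total as + squares as) ⟩
    _ ∎
    where
    open ≡-Reasoning
    l1 : ∀ v s q a → v - + 2 * s ≡ (v + q + a * a) - (+ 2 * s + a * a + q)
    l1 = solve-∀
    l2 : ∀ w d r → (w + d) - r ≡ d + (w - r)
    l2 = solve-∀

  -- Binomial form of the constants

  pascal : ∀ n k → + (suc n C suc k) ≡ + (n C k) + + (n C suc k)
  pascal n k = trans (cong +_ (sym (nCk+nC[k+1]≡[n+1]C[k+1] n k))) (pos-+ (n C k) (n C suc k))

  2C₂ : ∀ m → + 2 * + (suc m C 2) ≡ + m * (1ℤ + + m)
  2C₂ zero = refl
  2C₂ (suc m) = begin
    + 2 * + (suc (suc m) C 2) ≡⟨ cong (λ k → + 2 * k) (pascal (suc m) 1) ⟩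
    + 2 * (+ (suc m C 1) + + (suc m C 2)) ≡⟨ cong (λ k → + 2 * (+ k + + (suc m C 2))) (nC1≡n (suc m)) ⟩
    + 2 * (+ suc m + + (suc m C 2)) ≡⟨ *-distribˡ-+ (+ 2) (+ suc m) (+ (suc m C 2)) ⟩
    + 2 * + suc m + + 2 * + (suc m C 2) ≡⟨ cong (λ k → + 2 * + suc m + k) (2C₂ m) ⟩
    + 2 * + suc m + + m * (1ℤ + + m) ≡⟨ lem (+ m) ⟩
    + suc m * (1ℤ + + suc m) ∎
    where
    open ≡-Reasoning
    lem : ∀ m → + 2 * (1ℤ + m) + m * (1ℤ + m) ≡ (1ℤ + m) * (1ℤ + (1ℤ + m))
    lem = solve-∀

  6C₃ : ∀ m → + 6 * + (suc m C 3) ≡ (+ m - 1ℤ) * + m * (1ℤ + + m)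
  6C₃ zero = refl
  6C₃ (suc m) = begin
    + 6 * + (suc (suc m) C 3) ≡⟨ cong (λ k → + 6 * k) (pascal (suc m) 2) ⟩
    + 6 * (+ (suc m C 2) + + (suc m C 3)) ≡⟨ split (+ (suc m C 2)) (+ (suc m C 3)) ⟩
    + 3 * (+ 2 * + (suc m C 2)) + + 6 * + (suc m C 3) ≡⟨ cong₂ (λ u v → + 3 * u + v) (2C₂ m) (6C₃ m) ⟩
    + 3 * (+ m * (1ℤ + + m)) + (+ m - 1ℤ) * + m * (1ℤ + + m) ≡⟨ lem (+ m) ⟩
    (+ suc m - 1ℤ) * + suc m * (1ℤ + + suc m) ∎
    where
    open ≡-Reasoning
    split : ∀ a b → + 6 * (a + b) ≡ + 3 * (+ 2 * a) + + 6 * b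
    split = solve-∀
    lem : ∀ m → + 3 * (m * (1ℤ + m)) + (m - 1ℤ) * m * (1ℤ + m) ≡ (1ℤ + m - 1ℤ) * (1ℤ + m) * (1ℤ + (1ℤ + m))
    lem = solve-∀

  -- Writing t - pm = (t - p) - p(m - 1) splits the increment of `base` into multiples of m(m + 1)
  -- and (m - 1)m(m + 1), that is, of two binomial coefficients, and Pascal's rule sums them.
  base≡binomials : ∀ t p m →
    base t p m ≡ + 2 * + (suc m C 3) * (p * (t - p)) - + 6 * + (suc m C 4) * (p * p)
  base≡binomials t p zero = lem t p where
    lem : ∀ t p → 0ℤ ≡ + 2 * 0ℤ * (p * (t - p)) - + 6 * 0ℤ * (p * p)
    lem = solve-∀
  base≡binomials t p (suc m) = begin
    base t p m + + m * (1ℤ + + m) * (p * (t - p * + m))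
      ≡⟨ cong (λ k → k + + m * (1ℤ + + m) * (p * (t - p * + m))) (base≡binomials t p m) ⟩
    + 2 * C₃ * (p * (t - p)) - + 6 * C₄ * (p * p) + + m * (1ℤ + + m) * (p * (t - p * + m))
      ≡⟨ l1 t p (+ m) C₃ C₄ ⟩
    + 2 * C₃ * (p * (t - p)) - + 6 * C₄ * (p * p)
      + (+ m * (1ℤ + + m) * (p * (t - p)) - (+ m - 1ℤ) * + m * (1ℤ + + m) * (p * p))
      ≡⟨ cong₂ (λ u v → + 2 * C₃ * (p * (t - p)) - + 6 * C₄ * (p * p) + (u * (p * (t - p)) - v * (p * p)))
           (sym (2C₂ m)) (sym (6C₃ m)) ⟩
    + 2 * C₃ * (p * (t - p)) - + 6 * C₄ * (p * p) + (+ 2 * C₂ * (p * (t - p)) - + 6 * C₃ * (p * p))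
      ≡⟨ l2 t p C₂ C₃ C₄ ⟩
    + 2 * (C₂ + C₃) * (p * (t - p)) - + 6 * (C₃ + C₄) * (p * p)
      ≡⟨ cong₂ (λ u v → + 2 * u * (p * (t - p)) - + 6 * v * (p * p))
           (sym (pascal (suc m) 2)) (sym (pascal (suc m) 3)) ⟩
    + 2 * + (suc (suc m) C 3) * (p * (t - p)) - + 6 * + (suc (suc m) C 4) * (p * p) ∎
    where
    open ≡-Reasoning
    C₂ C₃ C₄ : ℤ
    C₂ = + (suc m C 2)
    C₃ = + (suc m C 3)
    C₄ = + (suc m C 4)
    l1 : ∀ t p m C₃ C₄ → + 2 * C₃ * (p * (t - p)) - + 6 * C₄ * (p * p) + m * (1ℤ + m) * (p * (t - p * m))
      ≡ + 2 * C₃ * (p * (t - p)) - + 6 * C₄ * (p * p)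
        + (m * (1ℤ + m) * (p * (t - p)) - (m - 1ℤ) * m * (1ℤ + m) * (p * p))
    l1 = solve-∀
    l2 : ∀ t p C₂ C₃ C₄ →
      + 2 * C₃ * (p * (t - p)) - + 6 * C₄ * (p * p) + (+ 2 * C₂ * (p * (t - p)) - + 6 * C₃ * (p * p))
      ≡ + 2 * (C₂ + C₃) * (p * (t - p)) - + 6 * (C₃ + C₄) * (p * p)
    l2 = solve-∀

  -- For t = pn + d the coefficient p²n + pd - p² is p(t - p). Both terms of the closed formula have
  -- this shape, with m = n + 1 and m = n.
  2formula≡ : ∀ p n d m u v →
    + 2 * (+ (suc m C 2) * u * v + + (suc m C 3) * (p * p * n + p * d - p * p) - + 3 * + (suc m C 4) * (p * p))
    ≡ + m * (1ℤ + + m) * (u * v) + base (p * n + d) p m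
  2formula≡ p n d m u v = begin
    _ ≡⟨ lem p n d u v (+ (suc m C 2)) (+ (suc m C 3)) (+ (suc m C 4)) ⟩
    _ ≡⟨ cong₂ (λ a b → a * (u * v) + b) (2C₂ m) (sym (base≡binomials (p * n + d) p m)) ⟩
    _ ∎
    where
    open ≡-Reasoning
    lem : ∀ p n d u v C₂ C₃ C₄ →
      + 2 * (C₂ * u * v + C₃ * (p * p * n + p * d - p * p) - + 3 * C₄ * (p * p))
      ≡ + 2 * C₂ * (u * v) + (+ 2 * C₃ * (p * (p * n + d - p)) - + 6 * C₄ * (p * p))
    lem = solve-∀

open QuadraticForm

open import Data.Nat
open import Data.Nat.Divisibility using (_∣_; divides; ∣-refl)
open import Data.Nat.DivMod
  using (m≡m%n+[m/n]*n; m%n<n; m/n*n≤m; m/n<m; [m+kn]%n≡m%n; +-distrib-/-∣ʳ; m*n/n≡m)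
open import Data.Nat.Properties
open import Data.Nat.Tactic.RingSolver using (solve-∀)
open import Data.List.Membership.DecPropositional _≟_ using (_∈?_)

-- First-column hook lengths

colLen-hit : ∀ {j x} xs → j ≤ x → colLen (x ∷ xs) j ≡ suc (colLen xs j)
colLen-hit {j} {x} xs j≤x with j ≤ᵇ x | ≤⇒≤ᵇ j≤x
... | true | _ = refl

colLen-miss : ∀ {j x} xs → x < j → colLen (x ∷ xs) j ≡ colLen xs j
colLen-miss {j} {x} xs x<j with j ≤ᵇ x | ≤ᵇ⇒≤ j x
... | true  | j≤x = contradiction (j≤x _) (<⇒≱ x<j)
... | false | _ = refl

colLen-≡0 : ∀ {j xs} → All (_< j) xs → colLen xs j ≡ 0
colLen-≡0 [] = refl
colLen-≡0 {xs = x ∷ xs} (x<j ∷ xs<j) = trans (colLen-miss xs x<j) (colLen-≡0 xs<j)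

colLen≤length : ∀ xs j → colLen xs j ≤ length xs
colLen≤length [] j = z≤n
colLen≤length (x ∷ xs) j with j ≤ᵇ x
... | true = s≤s (colLen≤length xs j)
... | false = m≤n⇒m≤1+n (colLen≤length xs j)

colLen-++ : ∀ {j ps} rs → All (j ≤_) ps → colLen (ps ++ rs) j ≡ length ps + colLen rs j
colLen-++ rs [] = refl
colLen-++ {ps = p ∷ ps} rs (j≤p ∷ j≤ps) = trans (colLen-hit (ps ++ rs) j≤p) (cong suc (colLen-++ rs j≤ps))

Decreasing : List ℕ → Set
Decreasing = AllPairs _>_

WeaklyDecreasing : List ℕ → Set
WeaklyDecreasing = AllPairs _≥_

-- In the first column a row `x` has arm x - 1 and leg `length xs`; the box itself adds 1.
beta : List ℕ → List ℕ
beta [] = []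
beta (x ∷ xs) = x + length xs ∷ beta xs

-- As k runs through ℕ this enumerates the complement of beta μ increasingly.
gap : List ℕ → ℕ → ℕ
gap μ k = k + (length μ ∸ colLen μ (suc k))

beta-< : ∀ {x xs} → All (_≤ x) xs → All (_< x + length xs) (beta xs)
beta-< [] = []
beta-< {x} {y ∷ xs} (y≤x ∷ xs≤x) = subst (y + length xs <_) (sym (+-suc x _)) (s≤s (+-monoˡ-≤ _ y≤x))
  ∷ All.map (λ {z} z< → <-trans z< (subst (x + length xs <_) (sym (+-suc x _)) ≤-refl)) (beta-< xs≤x)

beta-decreasing : ∀ {μ} → WeaklyDecreasing μ → Decreasing (beta μ)
beta-decreasing [] = []
beta-decreasing (xs≤x ∷ w) = beta-< xs≤x ∷ beta-decreasing w

gap-hit : ∀ {k x} xs → k < x → gap (x ∷ xs) k ≡ gap xs k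
gap-hit {k} xs k<x = cong (λ c → k + (suc (length xs) ∸ c)) (colLen-hit xs k<x)

gap-high : ∀ {k x xs} → All (_≤ x) xs → x ≤ k → gap xs k ≡ k + length xs
gap-high {k} {xs = xs} xs≤x x≤k =
  cong (λ c → k + (length xs ∸ c)) (colLen-≡0 (All.map (λ y≤x → s≤s (≤-trans y≤x x≤k)) xs≤x))

gap-low : ∀ {k x} xs → k < x → gap xs k < x + length xs
gap-low {k} xs k<x = +-mono-<-≤ k<x (m∸n≤m (length xs) (colLen xs (suc k)))

gap∉beta : ∀ {μ} → WeaklyDecreasing μ → ∀ k → gap μ k ∉ beta μ
gap∉beta {x ∷ xs} (xs≤x ∷ w) k g∈ with k <? x
... | yes k<x = miss (subst (_∈ beta (x ∷ xs)) (gap-hit xs k<x) g∈) where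
  miss : gap xs k ∉ beta (x ∷ xs)
  miss (here eq) = <⇒≢ (gap-low xs k<x) eq
  miss (there ∈xs) = gap∉beta w k ∈xs
... | no k≮x = miss (subst (_∈ beta (x ∷ xs)) (trans (gap-high (≤-refl ∷ xs≤x) x≤k) (+-suc k _)) g∈) where
  x≤k = ≮⇒≥ k≮x
  miss : suc (k + length xs) ∉ beta (x ∷ xs)
  miss (here eq) = <⇒≢ (s≤s (+-monoˡ-≤ (length xs) x≤k)) (sym eq)
  miss (there ∈xs) = <⇒≱ (All.lookup (beta-< xs≤x) ∈xs) (m≤n⇒m≤1+n (+-monoˡ-≤ (length xs) x≤k))

-- A new first row `x` removes exactly one number from the complement, the gap of `xs` with index
-- `x`, which is the new element `x + length xs`. Smaller indices are unaffected and larger ones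
-- drop by one.
gap-surjective : ∀ {μ} → WeaklyDecreasing μ → ∀ {y} → y ∉ beta μ → ∃[ k ] y ≡ gap μ k
gap-surjective [] {y} _ = y , sym (+-identityʳ y)
gap-surjective {x ∷ xs} (xs≤x ∷ w) {y} y∉ with gap-surjective w (λ ∈xs → y∉ (there ∈xs))
... | k , refl with <-cmp k x
... | tri< k<x _ _ = k , sym (gap-hit xs k<x)
... | tri≈ _ refl _ = contradiction (here (gap-high xs≤x ≤-refl)) y∉
... | tri> _ _ (s≤s {n = k-1} x≤k-1) = k-1 ,
  trans (gap-high xs≤x (m≤n⇒m≤1+n x≤k-1)) (trans (sym (+-suc k-1 _)) (sym (gap-high (≤-refl ∷ xs≤x) x≤k-1)))

-- The hook lengths of a partition are the differences between an element of its beta-set and a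
-- smaller missing number.
BetaHooks : (ℕ → Set) → List ℕ → Set
BetaHooks P μ = ∀ {s y} → s ∈ beta μ → y < s → y ∉ beta μ → P (s ∸ y)

-- All rows of `ps` reach column k + 1, so removing them and the row itself from the column length
-- leaves the leg, counted in `xs` alone.
rowHook≡ : ∀ {ps x xs k} → All (x ≤_) ps → k < x →
  (x ∸ suc k) + (colLen (ps ++ x ∷ xs) (suc k) ∸ suc (length ps)) + 1 ≡ (x + length xs) ∸ gap xs k
rowHook≡ {ps} {x} {xs} {k} x≤ps k<x = begin
  (x ∸ suc k) + (colLen (ps ++ x ∷ xs) (suc k) ∸ suc (length ps)) + 1
    ≡⟨ cong (λ c → (x ∸ suc k) + (c ∸ suc (length ps)) + 1) col≡ ⟩
  (x ∸ suc k) + ((length ps + suc c) ∸ suc (length ps)) + 1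
    ≡⟨ cong (λ e → (x ∸ suc k) + (e ∸ suc (length ps)) + 1) (+-suc (length ps) c) ⟩
  (x ∸ suc k) + ((length ps + c) ∸ length ps) + 1
    ≡⟨ cong (λ e → (x ∸ suc k) + e + 1) (m+n∸m≡n (length ps) c) ⟩
  (x ∸ suc k) + c + 1
    ≡⟨ sym (m+n∸n≡m _ (gap xs k)) ⟩
  (x ∸ suc k) + c + 1 + gap xs k ∸ gap xs k
    ≡⟨ cong (_∸ gap xs k) (lem (x ∸ suc k) c k (length xs ∸ c)) ⟩
  (x ∸ suc k + suc k) + (length xs ∸ c + c) ∸ gap xs k
    ≡⟨ cong₂ (λ a b → a + b ∸ gap xs k) (m∸n+n≡m k<x) (m∸n+n≡m (colLen≤length xs (suc k))) ⟩
  (x + length xs) ∸ gap xs k ∎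
  where
  open ≡-Reasoning
  c = colLen xs (suc k)
  col≡ : colLen (ps ++ x ∷ xs) (suc k) ≡ length ps + suc c
  col≡ = trans (colLen-++ (x ∷ xs) (All.map (≤-trans k<x) x≤ps)) (cong (length ps +_) (colLen-hit xs k<x))
  lem : ∀ a c k d → a + c + 1 + (k + d) ≡ (a + suc k) + (d + c)
  lem = solve-∀

extend : ∀ {x} {ps xs : List ℕ} → All (λ p → All (_≤ p) (x ∷ xs)) ps → All (_≤ x) xs →
  All (λ p → All (_≤ p) xs) (ps ++ x ∷ [])
extend ps≥ xs≤x = All.++⁺ (All.map All.tail ps≥) (xs≤x ∷ [])

module _ {P : ℕ → Set} where

  -- `hooksFrom` keeps the whole diagram while it descends, so the induction runs over suffixes `rs`
  -- below the rows `ps` already passed.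
  hooks⇒beta : ∀ ps {rs} → All (λ p → All (_≤ p) rs) ps → WeaklyDecreasing rs →
    All P (hooksFrom (ps ++ rs) (suc (length ps)) rs) → BetaHooks P rs
  hooks⇒beta ps {x ∷ xs} ps≥ (xs≤x ∷ w) all {s} {y} s∈ y<s y∉
    with All.++⁻ (rowHooks (ps ++ x ∷ xs) (suc (length ps)) x) all
  ... | row , rest with s∈
  ... | there s∈xs = hooks⇒beta (ps ++ x ∷ []) (extend ps≥ xs≤x) w
        (subst₂ (λ μ i → All P (hooksFrom μ i xs)) (sym (++-assoc ps (x ∷ []) xs))
          (cong suc (sym (trans (length-++ ps) (+-comm (length ps) 1)))) rest)
        s∈xs y<s (λ y∈ → y∉ (there y∈))
  ... | here refl with gap-surjective w (λ y∈ → y∉ (there y∈))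
  ... | k , refl with k <? x
  ... | yes k<x = subst P (rowHook≡ {xs = xs} (All.map All.head ps≥) k<x)
        (All.applyUpTo⁻ _ x (All.map⁻ row) k<x)
  ... | no k≮x = contradiction y<s
        (≤⇒≯ (subst (x + length xs ≤_) (sym (gap-high xs≤x (≮⇒≥ k≮x))) (+-monoˡ-≤ _ (≮⇒≥ k≮x))))

  beta⇒hooks : ∀ ps {rs} → All (λ p → All (_≤ p) rs) ps → WeaklyDecreasing rs →
    BetaHooks P rs → All P (hooksFrom (ps ++ rs) (suc (length ps)) rs)
  beta⇒hooks ps {[]} _ _ _ = []
  beta⇒hooks ps {x ∷ xs} ps≥ (xs≤x ∷ w) bh = All.++⁺
    (All.map⁺ (All.applyUpTo⁺₁ _ x (λ {k} k<x → subst P (sym (rowHook≡ {xs = xs} (All.map All.head ps≥) k<x))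
       (bh (here refl) (gap-low xs k<x)
         (λ g∈ → gap∉beta (xs≤x ∷ w) k (subst (_∈ beta (x ∷ xs)) (sym (gap-hit xs k<x)) g∈))))))
    (subst₂ (λ μ i → All P (hooksFrom μ i xs)) (++-assoc ps (x ∷ []) xs)
          (cong suc (trans (length-++ ps) (+-comm (length ps) 1)))
       (beta⇒hooks (ps ++ x ∷ []) (extend ps≥ xs≤x) w bh′))
    where
    -- A number missing from `beta xs` could be the first element of the longer beta-set, but that
    -- one exceeds every `s` in question.
    bh′ : BetaHooks P xs
    bh′ s∈ y<s y∉ = bh (there s∈) y<s λ
      { (here refl) → <⇒≱ (<-trans y<s (All.lookup (beta-< xs≤x) s∈)) ≤-refl
      ; (there y∈) → y∉ y∈ }

Closed : ℕ → List ℕ → Set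
Closed t S = ∀ {y} → y + t ∈ S → y ∈ S

-- Otherwise the pair `y + t`, `y` would give a hook of length `t` itself.
core⇒closed : ∀ {t μ} → 1 ≤ t → WeaklyDecreasing μ → IsCore t μ → Closed t (beta μ)
core⇒closed {t} {μ} 1≤t w core {y} y+t∈ with y ∈? beta μ
... | yes y∈ = y∈
... | no y∉ = contradiction (subst (t ∣_) (sym (m+n∸m≡n y t)) ∣-refl)
  (hooks⇒beta [] [] w core y+t∈ (subst (_≤ y + t) (+-comm y 1) (+-monoʳ-≤ y 1≤t)) y∉)

-- A hook s - y = qt is impossible: q subtractions of `t` lead from `s` to `y` within the set.
closed⇒core : ∀ {t μ} → WeaklyDecreasing μ → Closed t (beta μ) → IsCore t μ
closed⇒core {t} {μ} w closed = beta⇒hooks [] [] w λ {s} {y} s∈ y<s y∉ → λ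
  { (divides q eq) → y∉ (descend q (subst (_∈ beta μ)
      (trans (sym (m+[n∸m]≡n (<⇒≤ y<s))) (cong (y +_) eq)) s∈)) }
  where
  descend : ∀ q {y} → y + q * t ∈ beta μ → y ∈ beta μ
  descend zero {y} y∈ = subst (_∈ beta μ) (+-identityʳ y) y∈
  descend (suc q) {y} y∈ = descend q (closed (subst (_∈ beta μ) (lem y t (q * t)) y∈)) where
    lem : ∀ y t r → y + (t + r) ≡ y + r + t
    lem = solve-∀

-- The legs add up to ℓ(ℓ - 1)/2; the equation is doubled and rearranged to avoid division and
-- subtraction.
size-beta : ∀ μ → let ℓ = length μ in 2 * sum (beta μ) + ℓ ≡ 2 * size μ + ℓ * ℓ
size-beta [] = refl
size-beta (x ∷ xs) = begin
  2 * (x + length xs + sum (beta xs)) + suc (length xs) ≡⟨ l1 x (length xs) (sum (beta xs)) ⟩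
  2 * sum (beta xs) + length xs + (2 * x + 2 * length xs + 1)
    ≡⟨ cong (_+ (2 * x + 2 * length xs + 1)) (size-beta xs) ⟩
  2 * size xs + length xs * length xs + (2 * x + 2 * length xs + 1) ≡⟨ l2 x (length xs) (size xs) ⟩
  2 * (x + size xs) + suc (length xs) * suc (length xs) ∎
  where
  open ≡-Reasoning
  l1 : ∀ x l s → 2 * (x + l + s) + suc l ≡ 2 * s + l + (2 * x + 2 * l + 1)
  l1 = solve-∀
  l2 : ∀ x l s → 2 * s + l * l + (2 * x + 2 * l + 1) ≡ 2 * (x + s) + suc l * suc l
  l2 = solve-∀

length-beta : ∀ μ → length (beta μ) ≡ length μ
length-beta [] = refl
length-beta (x ∷ xs) = cong suc (length-beta xs)

beta-injective : ∀ {μ ν} → beta μ ≡ beta ν → μ ≡ ν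
beta-injective {[]} {[]} _ = refl
beta-injective {x ∷ xs} {y ∷ ys} eq with beta-injective {xs} {ys} (∷-injectiveʳ eq)
... | refl = cong (_∷ xs) (+-cancelʳ-≡ (length xs) x y (∷-injectiveˡ eq))

beta-positive : ∀ {μ} → All (1 ≤_) μ → All (1 ≤_) (beta μ)
beta-positive [] = []
beta-positive (1≤x ∷ 1≤xs) = m≤n⇒m≤n+o _ 1≤x ∷ beta-positive 1≤xs

beta-surjective : ∀ {S} → Decreasing S → All (1 ≤_) S → ∃[ μ ] (IsPartition μ × beta μ ≡ S)
beta-surjective [] [] = [] , ([] , []) , refl
beta-surjective {s ∷ S} (S<s ∷ dec) (1≤s ∷ 1≤S) with beta-surjective dec 1≤S
... | [] , _ , refl = s ∷ [] , (1≤s ∷ [] , [-]) , cong (_∷ []) (+-identityʳ s)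
... | y ∷ ys , (1≤y ∷ 1≤ys , linked) , refl = s ∸ suc (length ys) ∷ y ∷ ys ,
    (≤-trans 1≤y y≤x ∷ 1≤y ∷ 1≤ys , y≤x ∷ linked) ,
    cong (_∷ beta (y ∷ ys)) (m∸n+n≡m (≤-trans (s≤s (m≤n+m (length ys) y)) (All.head S<s)))
  where
  y≤x : y ≤ s ∸ suc (length ys)
  y≤x = m+n≤o⇒m≤o∸n y (subst (_≤ s) (sym (+-suc y (length ys))) (All.head S<s))

-- Windows of length t

unique-⊆⇒length≤ : ∀ {A : Set} {xs ys : List A} → 
  Unique xs → (∀ {x} → x ∈ xs → x ∈ ys) → length xs ≤ length ys
unique-⊆⇒length≤ [] _ = z≤n
unique-⊆⇒length≤ {xs = x ∷ xs} (x∉xs ∷ uniq) xs⊆ with ∈-∃++ (xs⊆ (here refl))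
... | as , bs , refl = subst (suc (length xs) ≤_) (sym len≡) (s≤s (unique-⊆⇒length≤ uniq sub))
  where
  len≡ : length (as ++ x ∷ bs) ≡ suc (length (as ++ bs))
  len≡ = trans (length-++ as) (trans (+-suc (length as) (length bs)) (cong suc (sym (length-++ as))))
  sub : ∀ {y} → y ∈ xs → y ∈ as ++ bs
  sub y∈ with ∈-++⁻ as (xs⊆ (there y∈))
  ... | inj₁ y∈as = ∈-++⁺ˡ y∈as
  ... | inj₂ (here refl) = contradiction refl (All.lookup x∉xs y∈)
  ... | inj₂ (there y∈bs) = ∈-++⁺ʳ as y∈bs

decreasing⇒unique : ∀ {S} → Decreasing S → Unique S
decreasing⇒unique = AllPairs.map >⇒≢

squeeze : ∀ {a a′ b b′} → a ≤ a′ → b ≤ b′ → a′ + b′ ≤ a + b → a ≡ a′ × b ≡ b′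
squeeze {a} {a′} {b} {b′} a≤ b≤ ≥ =
  ≤-antisym a≤ (+-cancelʳ-≤ b a′ a (≤-trans (+-monoʳ-≤ a′ b≤) ≥)) ,
  ≤-antisym b≤ (+-cancelˡ-≤ a b′ b (≤-trans (+-monoˡ-≤ b′ a≤) ≥))

-- The numbers B - 1, ..., B - a, the top of a window ending at `B`. This reading needs a ≤ B, as
-- `pred` stalls at 0.
block : ℕ → ℕ → List ℕ
block B zero = []
block B (suc a) = pred B ∷ block (pred B) a

block-∈⁻ : ∀ {B a x} → a ≤ B → x ∈ block B a → x < B × B ≤ x + a
block-∈⁻ {suc B} {suc a} _ (here refl) = ≤-refl , subst (suc B ≤_) (sym (+-suc B a)) (s≤s (m≤m+n B a))
block-∈⁻ {suc B} {suc a} {x} (s≤s a≤B) (there x∈) with block-∈⁻ a≤B x∈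
... | x<B , B≤x+a = m≤n⇒m≤1+n x<B , subst (suc B ≤_) (sym (+-suc x a)) (s≤s B≤x+a)

block-∈⁺ : ∀ {B a x} → x < B → B ≤ x + a → x ∈ block B a
block-∈⁺ {B} {zero} {x} x<B B≤x = contradiction (subst (B ≤_) (+-identityʳ x) B≤x) (<⇒≱ x<B)
block-∈⁺ {suc B} {suc a} {x} (s≤s x≤B) B≤x+a with x ≟ B
... | yes refl = here refl
... | no x≢B = there (block-∈⁺ (≤∧≢⇒< x≤B x≢B) (s≤s⁻¹ (subst (suc B ≤_) (+-suc x a) B≤x+a)))

block-decreasing : ∀ {B a} → a ≤ B → Decreasing (block B a)
block-decreasing {a = zero} _ = []
block-decreasing {suc B} {suc a} (s≤s a≤B) =
  All.tabulate (λ x∈ → proj₁ (block-∈⁻ a≤B x∈)) ∷ block-decreasing a≤B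

length-block : ∀ B a → length (block B a) ≡ a
length-block B zero = refl
length-block B (suc a) = cong suc (length-block (pred B) a)

sum-block : ∀ {B a} → a ≤ B → 2 * sum (block B a) + a * a + a ≡ 2 * (B * a)
sum-block {B} {zero} _ = cong (2 *_) (sym (*-zeroʳ B))
sum-block {suc B} {suc a} (s≤s a≤B) = trans (l1 B a (sum (block B a)))
    (trans (cong (_+ (2 * B + 2 * a + 2)) (sum-block a≤B)) (l2 B a))
  where
  l1 : ∀ B a s → 2 * (B + s) + suc a * suc a + suc a ≡ 2 * s + a * a + a + (2 * B + 2 * a + 2)
  l1 = solve-∀
  l2 : ∀ B a → 2 * (B * a) + (2 * B + 2 * a + 2) ≡ 2 * (suc B * suc a)
  l2 = solve-∀

-- The i-th largest element is at most B - i, and only the block meets all these bounds.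
sum-window≤ : ∀ {B w} → Decreasing w → All (_< B) w → let a = length w in
  2 * sum w + a * a + a ≤ 2 * (B * a) × (2 * (B * a) ≤ 2 * sum w + a * a + a → w ≡ block B a)
sum-window≤ {B} {[]} _ _ = z≤n , λ _ → refl
sum-window≤ {suc B} {x ∷ xs} (xs<x ∷ dec) (s≤s x≤B ∷ _)
  with sum-window≤ {B} dec (All.map (λ y<x → <-≤-trans y<x x≤B) xs<x)
... | bound , tight = subst₂ _≤_ (sym lhs≡) (sym rhs≡) (+-monoˡ-≤ _ (+-mono-≤ bound (*-monoʳ-≤ 2 x≤B))) ,
    λ ≥ → let s = squeeze bound (*-monoʳ-≤ 2 x≤B) (+-cancelʳ-≤ _ _ _ (subst₂ _≤_ rhs≡ lhs≡ ≥))
          in cong₂ _∷_ (*-cancelˡ-≡ x B 2 (proj₂ s)) (tight (≤-reflexive (sym (proj₁ s))))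
  where
  a = length xs
  lhs≡ : 2 * (x + sum xs) + suc a * suc a + suc a ≡ 2 * sum xs + a * a + a + 2 * x + (2 * a + 2)
  lhs≡ = lem x (sum xs) a where
    lem : ∀ x s a → 2 * (x + s) + suc a * suc a + suc a ≡ 2 * s + a * a + a + 2 * x + (2 * a + 2)
    lem = solve-∀
  rhs≡ : 2 * (suc B * suc a) ≡ 2 * (B * a) + 2 * B + (2 * a + 2)
  rhs≡ = lem B a where
    lem : ∀ B a → 2 * (suc B * suc a) ≡ 2 * (B * a) + 2 * B + (2 * a + 2)
    lem = solve-∀

splitAt≥ : ∀ {S} → Decreasing S → ∀ b → ∃[ W ] ∃[ R ]
  (S ≡ W ++ R × Decreasing W × Decreasing R × All (b ≤_) W × All (_< b) R)
splitAt≥ [] b = [] , [] , refl , [] , [] , [] , []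
splitAt≥ {s ∷ S} (S<s ∷ dec) b with b ≤? s
... | no b≰s = [] , s ∷ S , refl , [] , S<s ∷ dec , [] , s<b ∷ All.map (λ y<s → <-trans y<s s<b) S<s
  where s<b = ≰⇒> b≰s
... | yes b≤s with splitAt≥ dec b
... | W , R , refl , decW , decR , b≤W , R<b =
  s ∷ W , R , refl , All.++⁻ˡ W S<s ∷ decW , decR , b≤s ∷ b≤W , R<b

-- Window lengths are listed from the top window down.
sumSquares weight : List ℕ → ℕ
sumSquares [] = 0
sumSquares (a ∷ as) = a * a + sumSquares as
weight [] = 0
weight (a ∷ as) = suc (length as) * a + weight as

arithmetic : ℕ → ℕ → ℕ → List ℕ
arithmetic c p zero = []
arithmetic c p (suc m) = c ∷ arithmetic (c + p) p m

length-arithmetic : ∀ c p m → length (arithmetic c p m) ≡ m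
length-arithmetic c p zero = refl
length-arithmetic c p (suc m) = cong suc (length-arithmetic (c + p) p m)

-- Window lengths of a closed set

module Abacus (t p : ℕ) where

  blocks : List ℕ → List ℕ
  blocks [] = []
  blocks (a ∷ as) = block (suc (length as) * t) a ++ blocks as

  record BetaSet (S : List ℕ) : Set where
    field
      decreasing : Decreasing S
      closed : ∀ {j} → j ≤ p → Closed (t + j) S
      0∉ : 0 ∉ S

  -- At most k allowed subtractions would lead from kt + j to 0: t + p is subtracted as long as j ≥
  -- p, then t + j, and from then on `t`.
  multiples∉ : ∀ {S} → BetaSet S → ∀ k {j} → j ≤ k * p → k * t + j ∉ S
  multiples∉ β zero z≤n ∈S = BetaSet.0∉ β ∈S
  multiples∉ {S} β (suc k) {j} j≤ ∈S with p ≤? j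
  ... | yes p≤j = multiples∉ β k (m≤n+o⇒m∸n≤o j p j≤) (BetaSet.closed β ≤-refl (subst (_∈ S) eq ∈S))
    where
    lem : ∀ t r p i → t + r + (i + p) ≡ r + i + (t + p)
    lem = solve-∀
    eq : t + k * t + j ≡ k * t + (j ∸ p) + (t + p)
    eq = trans (cong (t + k * t +_) (sym (m∸n+n≡m p≤j))) (lem t (k * t) p (j ∸ p))
  ... | no p≰j = multiples∉ β k {0} z≤n (BetaSet.closed β (<⇒≤ (≰⇒> p≰j)) (subst (_∈ S) (lem t (k * t) j) ∈S))
    where
    lem : ∀ t r j → t + r + j ≡ r + 0 + (t + j)
    lem = solve-∀

  -- This limits the number of windows, and it keeps a `shadow` inside the next lower window.
  kp+kt<elements : ∀ {S} → BetaSet S → ∀ k {s} → s ∈ S → k * t ≤ s → k * p + k * t < s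
  kp+kt<elements {S} β k {s} s∈ kt≤s with k * p + k * t <? s
  ... | yes lt = lt
  ... | no ≮ = contradiction (subst (_∈ S) (sym (m+[n∸m]≡n kt≤s)) s∈)
    (multiples∉ β k (m≤n+o⇒m∸n≤o s (k * t) (subst (s ≤_) (+-comm (k * p) (k * t)) (≮⇒≥ ≮))))

  -- The elements of W shifted down by t, followed by the p numbers just below the smallest of them.
  shadow : ∀ {w W} → Decreasing (w ∷ W) → All (t + p ≤_) (w ∷ W) →
    ∃[ N ] (Decreasing N × length N ≡ length (w ∷ W) + p ×
      (∀ {n} → n ∈ N → ∃[ j ] (j ≤ p × n + (t + j) ∈ w ∷ W)))
  shadow {w} {[]} _ (t+p≤w ∷ _) =
      -- These are w - t - p, ..., w - t, one number for each allowed subtraction from the smallest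
      -- element.
      block (suc (w ∸ t)) (suc p) , block-decreasing len≤ , length-block (suc (w ∸ t)) (suc p) , members
    where
    t≤w = m+n≤o⇒m≤o t t+p≤w
    p≤w∸t : p ≤ w ∸ t
    p≤w∸t = m+n≤o⇒m≤o∸n p (subst (_≤ w) (+-comm t p) t+p≤w)
    len≤ = s≤s p≤w∸t
    members : ∀ {n} → n ∈ block (suc (w ∸ t)) (suc p) → ∃[ j ] (j ≤ p × n + (t + j) ∈ w ∷ [])
    members {n} n∈ with block-∈⁻ len≤ n∈
    ... | s≤s n≤ , ≤n+p = (w ∸ t) ∸ n , m≤n+o⇒m∸n≤o _ n (s≤s⁻¹ (subst (suc (w ∸ t) ≤_) (+-suc n p) ≤n+p)) ,
        here (trans (lem n t (w ∸ t ∸ n)) (trans (cong (t +_) (m+[n∸m]≡n n≤)) (m+[n∸m]≡n t≤w)))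
      where
      lem : ∀ n t d → n + (t + d) ≡ t + (n + d)
      lem = solve-∀
  shadow {w} {w′ ∷ W} (W<w ∷ dec) (t+p≤w ∷ t+p≤W) with shadow dec t+p≤W
  ... | N , decN , len , members = w ∸ t ∷ N , All.tabulate below ∷ decN , cong suc len , members′
    where
    t≤w = m+n≤o⇒m≤o t t+p≤w
    below : ∀ {n} → n ∈ N → n < w ∸ t
    below {n} n∈ with members n∈
    ... | j , _ , ∈W = m+n≤o⇒m≤o∸n (suc n) (≤-trans (s≤s (+-monoʳ-≤ n (m≤m+n t j))) (All.lookup W<w ∈W))
    members′ : ∀ {n} → n ∈ w ∸ t ∷ N → ∃[ j ] (j ≤ p × n + (t + j) ∈ w ∷ w′ ∷ W)
    members′ (here refl) = 0 , z≤n , here (trans (cong (w ∸ t +_) (+-identityʳ t)) (m∸n+n≡m t≤w))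
    members′ (there n∈) with members n∈
    ... | j , j≤p , ∈W = j , j≤p , there ∈W

  -- The head of the list is at least the number of elements of S in the top window.
  TopBound : List ℕ → List ℕ → Set
  TopBound S [] = ⊤
  TopBound S (a ∷ as) = ∀ {N} → Decreasing N → (∀ {n} → n ∈ N → n ∈ S × length as * t ≤ n) → length N ≤ a

  Grows : ℕ → ℕ → Set
  Grows a b = 1 ≤ a → a + p ≤ b

  -- `bound` and `tight` are `sum-window≤` added up over the windows. `topBound` allows the
  -- comparison with the next higher window and later shows that the top window is nonempty.
  record Levels (k : ℕ) (S : List ℕ) : Set where
    field
      as : List ℕ
      length-as : length as ≡ k
      length-S : length S ≡ sum as
      bound : 2 * sum S + (sumSquares as + sum as) ≤ 2 * (t * weight as)
      tight : 2 * (t * weight as) ≤ 2 * sum S + (sumSquares as + sum as) → S ≡ blocks as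
      topBound : TopBound S as
      grows : Linked Grows as

  levels : ∀ k {S} → BetaSet S → All (_< k * t) S → Levels k S
  levels zero {[]} β _ = record
    { as = [] ; length-as = refl ; length-S = refl ; bound = z≤n ; tight = λ _ → refl ; topBound = tt ; grows = [] }
  levels zero {_ ∷ _} _ (() ∷ _)
  levels (suc k) {S} β S< with splitAt≥ (BetaSet.decreasing β) (k * t)
  ... | W , R , refl , decW , decR , kt≤W , R<kt = record
    { as = length W ∷ as
    ; length-as = cong suc length-as
    ; length-S = trans (length-++ W) (cong (length W +_) length-S)
    ; bound = subst₂ _≤_ (sym lhs≡) (sym rhs≡) (+-mono-≤ (proj₁ window) bound)
    ; tight = λ ≥ → let s = squeeze (proj₁ window) bound (subst₂ _≤_ rhs≡ lhs≡ ≥) in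
        cong₂ _++_ (proj₂ window (≤-reflexive (sym (proj₁ s)))) (tight (≤-reflexive (sym (proj₂ s))))
    ; topBound = λ decN N⊆ → unique-⊆⇒length≤ (decreasing⇒unique decN)
        (λ n∈ → high∈W (proj₁ (N⊆ n∈)) (subst (λ l → l * t ≤ _) length-as (proj₂ (N⊆ n∈))))
    ; grows = grows′ as length-as topBound grows
    }
    where
    low∈R : ∀ {y} → y ∈ W ++ R → y < k * t → y ∈ R
    low∈R y∈ y< with ∈-++⁻ W y∈
    ... | inj₁ y∈W = contradiction (All.lookup kt≤W y∈W) (<⇒≱ y<)
    ... | inj₂ y∈R = y∈R
    high∈W : ∀ {y} → y ∈ W ++ R → k * t ≤ y → y ∈ W
    high∈W y∈ y≥ with ∈-++⁻ W y∈
    ... | inj₁ y∈W = y∈W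
    ... | inj₂ y∈R = contradiction y≥ (<⇒≱ (All.lookup R<kt y∈R))
    βR : BetaSet R
    βR = record
      { decreasing = decR
      ; closed = λ {j} j≤p {y} ∈R → low∈R (BetaSet.closed β j≤p (∈-++⁺ʳ W ∈R))
          (≤-<-trans (m≤m+n y (t + j)) (All.lookup R<kt ∈R))
      ; 0∉ = λ ∈R → BetaSet.0∉ β (∈-++⁺ʳ W ∈R)
      }
    open Levels (levels k βR R<kt)
    a = length W
    window : 2 * sum W + a * a + a ≤ 2 * (suc (length as) * t * a) ×
      (2 * (suc (length as) * t * a) ≤ 2 * sum W + a * a + a → W ≡ block (suc (length as) * t) a)
    window = sum-window≤ decW (subst (λ l → All (_< suc l * t) W) (sym length-as) (All.++⁻ˡ W S<))
    lhs≡ : 2 * sum (W ++ R) + (a * a + sumSquares as + (a + sum as))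
      ≡ 2 * sum W + a * a + a + (2 * sum R + (sumSquares as + sum as))
    lhs≡ = trans (cong (λ s → 2 * s + (a * a + sumSquares as + (a + sum as))) (sum-++ W R))
        (lem (sum W) (sum R) a (sumSquares as) (sum as))
      where
      lem : ∀ w r a q s → 2 * (w + r) + (a * a + q + (a + s)) ≡ 2 * w + a * a + a + (2 * r + (q + s))
      lem = solve-∀
    rhs≡ : 2 * (t * weight (a ∷ as)) ≡ 2 * (suc (length as) * t * a) + 2 * (t * weight as)
    rhs≡ = lem t (suc (length as)) a (weight as) where
      lem : ∀ t k a w → 2 * (t * (k * a + w)) ≡ 2 * (k * t * a) + 2 * (t * w)
      lem = solve-∀
    grows′ : ∀ as → length as ≡ k → TopBound R as → Linked Grows as → Linked Grows (length W ∷ as)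
    grows′ [] _ _ _ = [-]
    grows′ (a′ ∷ as) refl top linked = step W refl ∷ linked
      where
      k-1 = length as
      -- Here k ≥ 1, so kp ≥ p. This is the room for the `p` extra elements of the shadow in window
      -- k - 1.
      above : ∀ {w} → w ∈ W → t + k-1 * t + p < w
      above {w} w∈ = ≤-<-trans (subst (_≤ k * p + k * t) (+-comm p _) (+-monoˡ-≤ (k * t) (m≤m+n p (k-1 * p))))
        (kp+kt<elements β k (∈-++⁺ˡ w∈) (All.lookup kt≤W w∈))
      -- The shadow of a nonempty `W` lies in the window below and has `length W + p` elements, so
      -- `top` applies to it.
      step : ∀ W₀ → W ≡ W₀ → Grows (length W₀) a′
      step (w ∷ W′) eq _ with shadow (subst Decreasing eq decW)
              (subst (All (t + p ≤_)) eq (All.tabulate λ w∈ →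
                ≤-trans (+-monoˡ-≤ p (m≤m+n t (k-1 * t))) (<⇒≤ (above w∈))))
      ... | N , decN , len , members = subst (_≤ a′) len (top decN inR)
        where
        inR : ∀ {n} → n ∈ N → n ∈ R × k-1 * t ≤ n
        inR {n} n∈ with members n∈
        ... | j , j≤p , ∈W₀ = low∈R (BetaSet.closed β j≤p (∈-++⁺ˡ ∈W)) n< , n≥
          where
          ∈W = subst (n + (t + j) ∈_) (sym eq) ∈W₀
          lem1 : ∀ n t j → n + (t + j) ≡ t + (n + j)
          lem1 = solve-∀
          n< : n < k * t
          n< = +-cancelˡ-< t n (k * t) (≤-<-trans (subst (t + n ≤_) (sym (lem1 n t j)) (+-monoʳ-≤ t (m≤m+n n j)))
            (All.lookup (All.++⁻ˡ W S<) ∈W))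
          lem2 : ∀ t r p → t + r + p ≡ r + (t + p)
          lem2 = solve-∀
          n≥ : k-1 * t ≤ n
          n≥ = +-cancelʳ-≤ (t + p) (k-1 * t) n (≤-trans
            (<⇒≤ (subst (_< n + (t + j)) (lem2 t (k-1 * t) p) (above ∈W)))
            (+-monoʳ-≤ n (+-monoʳ-≤ t j≤p)))

  -- Closed sets with window lengths in arithmetic progression

  arithmetic-head< : ∀ {c} m → c + suc m * p < t + p → c < t
  arithmetic-head< {c} m lt = +-cancelʳ-< p c t (≤-<-trans (+-monoʳ-≤ c (m≤m+n p (m * p))) lt)

  arithmetic-tail< : ∀ {c} m → c + suc m * p < t + p → (c + p) + m * p < t + p
  arithmetic-tail< {c} m = subst (_< t + p) (sym (+-assoc c p (m * p)))

  ≤suc* : ∀ {c} m → c < t → c ≤ suc m * t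
  ≤suc* m c<t = ≤-trans (<⇒≤ c<t) (m≤m+n t (m * t))

  topBlock : ∀ c m → List ℕ
  topBlock c m = block (suc (length (arithmetic (c + p) p m)) * t) c

  topBlock≡ : ∀ c m → topBlock c m ≡ block (suc m * t) c
  topBlock≡ c m = cong (λ l → block (suc l * t) c) (length-arithmetic (c + p) p m)

  ∈topBlock⁻ : ∀ {c x} m → c < t → x ∈ topBlock c m → x < suc m * t × suc m * t ≤ x + c
  ∈topBlock⁻ {c} m c<t x∈ = block-∈⁻ (≤suc* m c<t) (subst (_ ∈_) (topBlock≡ c m) x∈)

  arithmetic-blocks-< : ∀ c m → c + m * p < t + p → All (_< m * t) (blocks (arithmetic c p m))
  arithmetic-blocks-< c zero _ = []
  arithmetic-blocks-< c (suc m) lt = All.++⁺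
    (All.tabulate λ x∈ → proj₁ (∈topBlock⁻ m (arithmetic-head< m lt) x∈))
    (All.map (λ x< → <-≤-trans x< (m≤n+m (m * t) t)) (arithmetic-blocks-< (c + p) m (arithmetic-tail< m lt)))

  -- For m ≥ 1 the hypothesis says that the bottom window, with c + (m - 1)p elements, is not full,
  -- so 0 stays out. Subtracting t + j from one of the `c` largest numbers of a window gives one of
  -- the c + p largest of the window below.
  arithmetic-blocks : ∀ c m → c + m * p < t + p → BetaSet (blocks (arithmetic c p m))
  arithmetic-blocks c zero _ = record { decreasing = [] ; closed = λ _ () ; 0∉ = λ () }
  arithmetic-blocks c (suc m) lt = record
    { decreasing = AllPairs.++⁺ (subst Decreasing (sym (topBlock≡ c m)) (block-decreasing (≤suc* m c<t))) decreasing
        (All.tabulate λ x∈ → All.map (λ y< → <-≤-trans y< (above x∈)) tail<)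
    ; closed = closed′ ; 0∉ = zero∉ }
    where
    c<t = arithmetic-head< m lt
    rest = arithmetic-blocks (c + p) m (arithmetic-tail< m lt)
    open BetaSet rest
    tail< = arithmetic-blocks-< (c + p) m (arithmetic-tail< m lt)
    above : ∀ {x} → x ∈ topBlock c m → m * t ≤ x
    above {x} x∈ = +-cancelʳ-≤ t (m * t) x (≤-trans (≤-reflexive (+-comm (m * t) t))
       (≤-trans (proj₂ (∈topBlock⁻ m c<t x∈)) (+-monoʳ-≤ x (<⇒≤ c<t))))
    zero∉ : 0 ∉ topBlock c m ++ blocks (arithmetic (c + p) p m)
    zero∉ ∈S with ∈-++⁻ (topBlock c m) ∈S
    ... | inj₁ ∈top = contradiction (proj₂ (∈topBlock⁻ m c<t ∈top)) (<⇒≱ (<-≤-trans c<t (m≤m+n t (m * t))))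
    ... | inj₂ ∈rest = 0∉ ∈rest
    next : ∀ {y} m → y < m * t → m * t ≤ y + (c + p) → y ∈ blocks (arithmetic (c + p) p m)
    next zero () _
    next {y} (suc m) y< ≤y = ∈-++⁺ˡ (subst (y ∈_) (sym (topBlock≡ (c + p) m)) (block-∈⁺ y< ≤y))
    closed′ : ∀ {j} → j ≤ p → Closed (t + j) (topBlock c m ++ blocks (arithmetic (c + p) p m))
    closed′ {j} j≤p {y} ∈S with ∈-++⁻ (topBlock c m) ∈S
    ... | inj₂ ∈rest = ∈-++⁺ʳ (topBlock c m) (closed j≤p ∈rest)
    ... | inj₁ ∈top = ∈-++⁺ʳ (topBlock c m) (next m y< ≤y)
      where
      l1 : ∀ y t j → y + (t + j) ≡ t + (y + j)
      l1 = solve-∀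
      l2 : ∀ y t j c → y + (t + j) + c ≡ t + (y + (c + j))
      l2 = solve-∀
      y< : y < m * t
      y< = +-cancelˡ-< t y (m * t) (≤-<-trans (subst (t + y ≤_) (sym (l1 y t j)) (+-monoʳ-≤ t (m≤m+n y j)))
        (proj₁ (∈topBlock⁻ m c<t ∈top)))
      ≤y : m * t ≤ y + (c + p)
      ≤y = ≤-trans (+-cancelˡ-≤ t (m * t) (y + (c + j))
          (subst (suc m * t ≤_) (l2 y t j c) (proj₂ (∈topBlock⁻ m c<t ∈top))))
        (+-monoʳ-≤ y (+-monoʳ-≤ c j≤p))

  sum-arithmetic-blocks : ∀ c m → c + m * p < t + p → let as = arithmetic c p m in
    length (blocks as) ≡ sum as × 2 * sum (blocks as) + (sumSquares as + sum as) ≡ 2 * (t * weight as)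
  sum-arithmetic-blocks c zero _ = refl , cong (2 *_) (sym (*-zeroʳ t))
  sum-arithmetic-blocks c (suc m) lt with sum-arithmetic-blocks (c + p) m (arithmetic-tail< m lt)
  ... | len≡ , sum≡ = trans (length-++ (topBlock c m)) (cong₂ _+_ (length-block _ c) len≡) , (begin
      2 * sum (topBlock c m ++ blocks as) + (c * c + sumSquares as + (c + sum as))
        ≡⟨ cong (λ s → 2 * s + (c * c + sumSquares as + (c + sum as))) (sum-++ (topBlock c m) (blocks as)) ⟩
      2 * (sum (topBlock c m) + sum (blocks as)) + (c * c + sumSquares as + (c + sum as))
        ≡⟨ l1 (sum (topBlock c m)) (sum (blocks as)) c (sumSquares as) (sum as) ⟩
      2 * sum (topBlock c m) + c * c + c + (2 * sum (blocks as) + (sumSquares as + sum as))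
        ≡⟨ cong₂ _+_ (sum-block c≤) sum≡ ⟩
      2 * (suc (length as) * t * c) + 2 * (t * weight as)
        ≡⟨ l2 t (suc (length as)) c (weight as) ⟩
      2 * (t * (suc (length as) * c + weight as)) ∎)
    where
    open ≡-Reasoning
    as = arithmetic (c + p) p m
    c≤ : c ≤ suc (length as) * t
    c≤ = ≤suc* (length as) (arithmetic-head< m lt)
    l1 : ∀ w r a q s → 2 * (w + r) + (a * a + q + (a + s)) ≡ 2 * w + a * a + a + (2 * r + (q + s))
    l1 = solve-∀
    l2 : ∀ t k a w → 2 * (k * t * a) + 2 * (t * w) ≡ 2 * (t * (k * a + w))
    l2 = solve-∀

-- Passage from natural numbers to integers

open import Data.Integer using (+_)
open import Data.Integer as ℤ using (ℤ; 0ℤ; 1ℤ; +≤+)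
import Data.Integer.Properties as ℤ
import Data.Integer.Tactic.RingSolver as ℤRing

total-+ : ∀ as → total (map +_ as) ≡ + sum as
total-+ [] = refl
total-+ (a ∷ as) = cong (λ z → + a ℤ.+ z) (total-+ as)

squares-+ : ∀ as → squares (map +_ as) ≡ + sumSquares as
squares-+ [] = refl
squares-+ (a ∷ as) = cong₂ ℤ._+_ (sym (ℤ.pos-* a a)) (squares-+ as)

weighted-+ : ∀ as → weighted (map +_ as) ≡ + weight as
weighted-+ [] = refl
weighted-+ (a ∷ as) = cong₂ ℤ._+_
  (trans (cong (λ l → + suc l ℤ.* + a) (length-map +_ as)) (sym (ℤ.pos-* (suc (length as)) a))) (weighted-+ as)

excess-constant⇒arithmetic : ∀ p x e as → All (_≡ + e) (excess (+ p) (+ x) (map +_ as)) →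
  as ≡ arithmetic (x + e) p (length as)
excess-constant⇒arithmetic p x e [] _ = refl
excess-constant⇒arithmetic p x e (a ∷ as) (a-x≡e ∷ rest) = cong₂ _∷_
  (ℤ.+-injective (trans (lem (+ a) (+ x)) (cong (λ z → + x ℤ.+ z) a-x≡e)))
  (trans (excess-constant⇒arithmetic p (x + p) e as rest)
    (cong (λ c → arithmetic c p (length as)) (lem′ x p e)))
  where
  lem : ∀ a x → a ≡ x ℤ.+ (a ℤ.- x)
  lem = ℤRing.solve-∀
  lem′ : ∀ x p e → x + p + e ≡ x + e + p
  lem′ = solve-∀

excess-arithmetic : ∀ p x m → All (_≡ 0ℤ) (excess (+ p) (+ x) (map +_ (arithmetic x p m)))
excess-arithmetic p x zero = []
excess-arithmetic p x (suc m) = ℤ.+-inverseʳ (+ x) ∷ excess-arithmetic p (x + p) m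

-- A nonempty top window makes all lower ones nonempty, so the premise of `Grows` is met throughout
-- and every step down adds at least `p`.
excess-sorted : ∀ {t p a as} x → 1 ≤ a → Linked (Abacus.Grows t p) (a ∷ as) →
  Linked ℤ._≤_ (excess (+ p) x (map +_ (a ∷ as)))
excess-sorted x _ [-] = [-]
excess-sorted {t} {p} {a} {b ∷ as} x 1≤a (grow ∷ linked) =
  ℤ.0≤i-j⇒j≤i (subst (0ℤ ℤ.≤_) (lem (+ a) (+ b) (+ p) x) (ℤ.i≤j⇒0≤j-i (+≤+ (grow 1≤a)))) ∷
  excess-sorted {t} (x ℤ.+ + p) (≤-trans 1≤a (≤-trans (m≤m+n a p) (grow 1≤a))) linked
  where
  lem : ∀ a b p x → b ℤ.- (a ℤ.+ p) ≡ b ℤ.- (x ℤ.+ p) ℤ.- (a ℤ.- x)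
  lem = ℤRing.solve-∀

bit%2 : ∀ k → IsBit (+ (k % 2))
bit%2 k with k % 2 | m%n<n k 2
... | 0 | _ = inj₁ refl
... | 1 | _ = inj₂ refl
... | suc (suc _) | s≤s (s≤s ())

partition⇒weaklyDecreasing : ∀ {μ} → IsPartition μ → WeaklyDecreasing μ
partition⇒weaklyDecreasing (_ , linked) = Linked⇒AllPairs (λ x≥y y≥z → ≤-trans y≥z x≥y) linked

-- Bounding the size of a core

module Extremal (t p n d : ℕ) (1≤t : 1 ≤ t) (1≤p : 1 ≤ p)
  (t≡ : t ≡ p * n + d) (1≤d : 1 ≤ d) (d≤p : d ≤ p) where

  open Abacus t p

  -- `X m` and `E m` solve t + p = 2x + ε + pm with ε in {0, 1}. The truncated subtraction is exact
  -- for m ≤ n + 1, by `pm<t+p`.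
  rest X E : ℕ → ℕ
  rest m = t + p ∸ p * m
  X m = rest m / 2
  E m = rest m % 2

  V : ℕ → ℤ
  V m = value (+ t) (+ p) m (+ X m) (+ E m)

  pm<t+p : ∀ {m} → m ≤ suc n → p * m < t + p
  pm<t+p {m} m≤ = ≤-<-trans (*-monoʳ-≤ p m≤) (subst₂ _<_ (sym (*-suc p n))
      (trans (lem p (p * n) d) (cong (_+ p) (sym t≡))) (m<m+n (p + p * n) 1≤d))
    where
    lem : ∀ p q d → p + q + d ≡ q + d + p
    lem = solve-∀

  halves : ∀ {m} → m ≤ suc n → 2 * X m + E m + p * m ≡ t + p
  halves {m} m≤ = trans (cong (_+ p * m) (trans (lem (X m) (E m)) (sym (m≡m%n+[m/n]*n (rest m) 2))))
      (m∸n+n≡m (<⇒≤ (pm<t+p m≤)))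
    where
    lem : ∀ x e → 2 * x + e ≡ e + x * 2
    lem = solve-∀

  halvesℤ : ∀ {m} → m ≤ suc n → + t ℤ.+ + p ≡ + 2 ℤ.* + X m ℤ.+ + E m ℤ.+ + p ℤ.* + m
  halvesℤ {m} m≤ = trans (cong +_ (sym (halves m≤)))
    (cong₂ (λ a b → a ℤ.+ + E m ℤ.+ b) (ℤ.pos-* 2 (X m)) (ℤ.pos-* p m))

  halvesℤ-length : ∀ {m l} → l ≡ m → m ≤ suc n → + t ℤ.+ + p ≡ + 2 ℤ.* + X m ℤ.+ + E m ℤ.+ + p ℤ.* + l
  halvesℤ-length refl = halvesℤ

  2≤t+p : 0ℤ ℤ.≤ + t ℤ.+ + p ℤ.- + 2
  2≤t+p = ℤ.i≤j⇒0≤j-i (+≤+ (+-mono-≤ 1≤t 1≤p))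

  -- `value-<` asks for t - p(m + 1) ≥ 1, which t = pn + d with d ≥ 1 grants up to m + 1 = n. `V n`
  -- and `V (suc n)` are left uncompared, hence the maximum in the formula.
  V-suc : ∀ {m} → suc m ≤ n → V m ℤ.< V (suc m)
  V-suc {m} m<n = value-< m (+ X m) (+ X (suc m)) (bit%2 (rest m)) (bit%2 (rest (suc m)))
    (ℤ.i≤j⇒0≤j-i (+≤+ 1≤p)) 1≤t-pm
    (halvesℤ (m≤n⇒m≤1+n (<⇒≤ m<n))) (halvesℤ (m≤n⇒m≤1+n m<n))
    where
    1+pm≤t : p * suc m + 1 ≤ t
    1+pm≤t = subst (p * suc m + 1 ≤_) (sym t≡) (+-mono-≤ (*-monoʳ-≤ p m<n) 1≤d)
    lem : ∀ t q → t ℤ.- (q ℤ.+ 1ℤ) ≡ t ℤ.- q ℤ.- 1ℤ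
    lem = ℤRing.solve-∀
    1≤t-pm : 0ℤ ℤ.≤ + t ℤ.- + p ℤ.* + suc m ℤ.- 1ℤ
    1≤t-pm = subst (0ℤ ℤ.≤_)
      (trans (lem (+ t) (+ (p * suc m))) (cong (λ z → + t ℤ.- z ℤ.- 1ℤ) (ℤ.pos-* p (suc m))))
      (ℤ.i≤j⇒0≤j-i (+≤+ 1+pm≤t))

  V-mono-< : ∀ {m k} → m <′ k → k ≤ n → V m ℤ.< V k
  V-mono-< <′-base k≤n = V-suc k≤n
  V-mono-< (<′-step m<k) k≤n = ℤ.<-trans (V-mono-< m<k (<⇒≤ k≤n)) (V-suc k≤n)

  slack≡ : ∀ as s → + 2 ℤ.* + t ℤ.* weighted (map +_ as)
      ℤ.- (+ 2 ℤ.* + s ℤ.+ total (map +_ as) ℤ.* total (map +_ as) ℤ.+ squares (map +_ as))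
    ≡ + (2 * (t * weight as)) ℤ.- + (2 * s + sum as * sum as + sumSquares as)
  slack≡ as s rewrite total-+ as | squares-+ as | weighted-+ as = cong₂ ℤ._-_
    (trans (ℤ.*-assoc (+ 2) (+ t) (+ weight as))
      (trans (cong (λ z → + 2 ℤ.* z) (sym (ℤ.pos-* t (weight as)))) (sym (ℤ.pos-* 2 (t * weight as)))))
    (cong₂ (λ u v → u ℤ.+ v ℤ.+ + sumSquares as) (sym (ℤ.pos-* 2 s)) (sym (ℤ.pos-* (sum as) (sum as))))

  V-size : ∀ {m} as s → length as ≡ m → m ≤ suc n →
    V m ℤ.- + 2 ℤ.* + s ≡ defect (+ t) (+ p) (+ E m) (excess (+ p) (+ X m) (map +_ as))
      ℤ.+ (+ (2 * (t * weight as)) ℤ.- + (2 * s + sum as * sum as + sumSquares as))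
  V-size {m} as s refl m≤ = trans
    (subst (λ l → value (+ t) (+ p) l (+ X m) (+ E m) ℤ.- + 2 ℤ.* + s ≡
        defect (+ t) (+ p) (+ E m) (excess (+ p) (+ X m) (map +_ as)) 
          ℤ.+ (+ 2 ℤ.* + t ℤ.* weighted (map +_ as)
            ℤ.- (+ 2 ℤ.* + s ℤ.+ total (map +_ as) ℤ.* total (map +_ as) ℤ.+ squares (map +_ as))))
      (length-map +_ as)
      (value-size (+ X m) (+ E m) (map +_ as) (halvesℤ-length (length-map +_ as) m≤) (+ s)))
    (cong (λ z → defect (+ t) (+ p) (+ E m) (excess (+ p) (+ X m) (map +_ as)) ℤ.+ z) (slack≡ as s))

  size-lengths : ∀ μ as → length (beta μ) ≡ sum as →
    2 * sum (beta μ) + (sumSquares as + sum as) ≡ 2 * size μ + sum as * sum as + sumSquares as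
  size-lengths μ as len = begin
    2 * sum (beta μ) + (sumSquares as + sum as) ≡⟨ l1 (sum (beta μ)) (sumSquares as) (sum as) ⟩
    (2 * sum (beta μ) + sum as) + sumSquares as ≡⟨ cong (_+ sumSquares as) sz ⟩
    2 * size μ + sum as * sum as + sumSquares as ∎
    where
    open ≡-Reasoning
    l1 : ∀ b q s → 2 * b + (q + s) ≡ 2 * b + s + q
    l1 = solve-∀
    sz : 2 * sum (beta μ) + sum as ≡ 2 * size μ + sum as * sum as
    sz = subst (λ l → 2 * sum (beta μ) + l ≡ 2 * size μ + l * l) (trans (sym (length-beta μ)) len) (size-beta μ)

  core⇒betaSet : ∀ {μ} → IsMultiCore t p μ → BetaSet (beta μ)
  core⇒betaSet {μ} (part@(pos , _) , cores) = record
    { decreasing = beta-decreasing w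
    ; closed = λ {j} j≤p → core⇒closed (m≤n⇒m≤n+o j 1≤t) w (cores j j≤p)
    ; 0∉ = λ 0∈ → contradiction (All.lookup (beta-positive pos) 0∈) λ () }
    where w = partition⇒weaklyDecreasing part

  betaSet⇒core : ∀ {S} → BetaSet S → ∃[ μ ] (IsMultiCore t p μ × beta μ ≡ S)
  betaSet⇒core {S} β with beta-surjective (BetaSet.decreasing β)
    (All.tabulate λ { {zero} 0∈ → contradiction 0∈ (BetaSet.0∉ β) ; {suc _} _ → s≤s z≤n })
  ... | μ , part , refl = μ , (part , λ j j≤p →
      closed⇒core (partition⇒weaklyDecreasing part) (BetaSet.closed β j≤p)) , refl

  -- The two zeros of the defect. They coincide if `E m` is 0; `X m + 0` is left as it is to match
  -- the common form `X m + e`.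
  Extreme : ℕ → List ℕ → Set
  Extreme m S = S ≡ blocks (arithmetic (X m + 0) p m) ⊎ S ≡ blocks (arithmetic (X m + E m) p m)

  Bounded : List ℕ → ℕ → Set
  Bounded μ m = m ≤ suc n × + 2 ℤ.* + size μ ℤ.≤ V m × (V m ℤ.≤ + 2 ℤ.* + size μ → Extreme m (beta μ))

  -- V - 2 · size is the defect plus the slack of the windows, both nonnegative. If it vanishes, the
  -- slack makes the windows blocks and the defect fixes their lengths.
  lengths⇒bounded : ∀ μ {m} (L : Levels m (beta μ)) → m ≤ suc n →
    Linked ℤ._≤_ (excess (+ p) (+ X m) (map +_ (Levels.as L))) → Bounded μ m
  lengths⇒bounded μ {m} L m≤ linked =
    m≤ , ℤ.0≤i-j⇒j≤i (subst (0ℤ ℤ.≤_) (sym gap≡) (0≤+ 0≤defect′ 0≤slack)) , extreme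
    where
    open Levels L
    ys = excess (+ p) (+ X m) (map +_ as)
    slack = + (2 * (t * weight as)) ℤ.- + (2 * size μ + sum as * sum as + sumSquares as)
    sorted : Sorted ys
    sorted = Linked⇒AllPairs ℤ.≤-trans linked
    gap≡ : V m ℤ.- + 2 ℤ.* + size μ ≡ defect (+ t) (+ p) (+ E m) ys ℤ.+ slack
    gap≡ = V-size as (size μ) length-as m≤
    0≤defect′ : 0ℤ ℤ.≤ defect (+ t) (+ p) (+ E m) ys
    0≤defect′ = 0≤defect {+ t} {+ p} (bit%2 (rest m)) 2≤t+p sorted
    0≤slack : 0ℤ ℤ.≤ slack
    0≤slack = ℤ.i≤j⇒0≤j-i (+≤+ (subst (_≤ 2 * (t * weight as)) (size-lengths μ as length-S) bound))
    extreme : V m ℤ.≤ + 2 ℤ.* + size μ → Extreme m (beta μ)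
    extreme V≤ = [ (λ c → inj₁ (uniform 0 c)) , (λ c → inj₂ (uniform (E m) c)) ]′
        (defect≤0⇒constant {+ t} {+ p} (bit%2 (rest m)) 2≤t+p sorted
          (ℤ.≤-reflexive (0≤i+j≤0⇒i≡0 0≤defect′ 0≤slack sum≤0)))
      where
      sum≤0 : defect (+ t) (+ p) (+ E m) ys ℤ.+ slack ℤ.≤ 0ℤ
      sum≤0 = subst (ℤ._≤ 0ℤ) gap≡ (ℤ.i≤j⇒i-j≤0 V≤)
      weight≡ : 2 * (t * weight as) ≡ 2 * size μ + sum as * sum as + sumSquares as
      weight≡ = ℤ.+-injective (ℤ.i-j≡0⇒i≡j _ _ (0≤i+j≤0⇒j≡0 0≤defect′ 0≤slack sum≤0))
      beta≡ : beta μ ≡ blocks as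
      beta≡ = tight (≤-reflexive (trans weight≡ (sym (size-lengths μ as length-S))))
      uniform : ∀ e → All (_≡ + e) ys → beta μ ≡ blocks (arithmetic (X m + e) p m)
      uniform e const = trans beta≡ (cong blocks (subst (λ l → as ≡ arithmetic (X m + e) p l) length-as
        (excess-constant⇒arithmetic p (X m) e as const)))

  sortedLevels : ∀ {S} → BetaSet S → ∃[ m ] (m ≤ suc n ×
    ∃[ L ] Linked ℤ._≤_ (excess (+ p) (+ X m) (map +_ (Levels.as {m} {S} L))))
  sortedLevels {[]} β = 0 , z≤n , L , sorted L
    where
    L = levels 0 β []
    sorted : ∀ {S} (L : Levels 0 S) → Linked ℤ._≤_ (excess (+ p) (+ X 0) (map +_ (Levels.as L)))
    sorted record { as = [] } = []
    sorted record { as = _ ∷ _ ; length-as = () }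
  sortedLevels {s ∷ S} β = suc k , s≤s k≤n , L , sorted L
    where
    instance t≢0 : NonZero t
    t≢0 = >-nonZero 1≤t
    k = s / t
    s< : s < suc k * t
    s< = subst (_< suc k * t) (sym (m≡m%n+[m/n]*n s t)) (+-monoˡ-< (k * t) (m%n<n s t))
    -- The largest element satisfies kp + kt < s < (k + 1)t, so kp < t ≤ (n + 1)p.
    k≤n : k ≤ n
    k≤n = s≤s⁻¹ (*-cancelʳ-< p k (suc n) (<-≤-trans kp<t t≤))
      where
      kp<t : k * p < t
      kp<t = +-cancelʳ-< (k * t) (k * p) t (<-trans (kp+kt<elements β k (here refl) (m/n*n≤m s t)) s<)
      t≤ : t ≤ suc n * p
      t≤ = subst₂ _≤_ (trans (+-comm d (p * n)) (sym t≡)) (cong (λ z → p + z) (*-comm p n))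
        (+-monoˡ-≤ (p * n) d≤p)
    L : Levels (suc k) (s ∷ S)
    L = levels (suc k) β (s< ∷ All.map (λ y<s → <-trans y<s s<) (AllPairs.head (BetaSet.decreasing β)))
    sorted : (L : Levels (suc k) (s ∷ S)) → Linked ℤ._≤_ (excess (+ p) (+ X (suc k)) (map +_ (Levels.as L)))
    sorted record { as = [] ; length-as = () }
    sorted record { as = a ∷ as ; length-as = l≡ ; topBound = top ; grows = grows } =
      -- The one-element list of the maximum `s` shows that the top window is nonempty.
      excess-sorted {t} (+ X (suc k)) (top {s ∷ []} ([] ∷ []) λ
        { (here refl) → here refl , subst (λ l → l * t ≤ s) (suc-injective (sym l≡)) (m/n*n≤m s t) }) grows

  core⇒bounded : ∀ {μ} → IsMultiCore t p μ → ∃[ m ] Bounded μ m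
  core⇒bounded {μ} core with sortedLevels (core⇒betaSet core)
  ... | m , m≤ , L , linked = m , lengths⇒bounded μ L m≤ linked

  -- Blocks with lengths X, X + p, ... have zero excess and zero slack. They form a closed set
  -- without 0 because X, half of the positive number `rest m`, is smaller than it.
  attained : ∀ {m} → m ≤ suc n → ∃[ μ ] (IsMultiCore t p μ × + 2 ℤ.* + size μ ≡ V m)
  attained {m} m≤ with betaSet⇒core (arithmetic-blocks (X m) m lt) | sum-arithmetic-blocks (X m) m lt
    where
    0<rest : 0 < rest m
    0<rest = m<n⇒0<n∸m (pm<t+p m≤)
    X<rest : X m < rest m
    X<rest = m/n<m (rest m) 2 {{>-nonZero 0<rest}} (s≤s (s≤s z≤n))
    lt : X m + m * p < t + p
    lt = subst₂ _<_ (cong (λ z → X m + z) (*-comm p m)) (m∸n+n≡m (<⇒≤ (pm<t+p m≤))) (+-monoˡ-< (p * m) X<rest)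
  ... | μ , core , β≡ | len≡ , sum≡ = μ , core , sym (ℤ.i-j≡0⇒i≡j _ _
      (trans (V-size as (size μ) (length-arithmetic (X m) p m) m≤)
        (cong₂ ℤ._+_ (defect-zero (+ t) (+ p) (+ E m) (excess-arithmetic p (X m) m)) (ℤ.i≡j⇒i-j≡0 (cong +_ weight≡)))))
    where
    as = arithmetic (X m) p m
    weight≡ : 2 * (t * weight as) ≡ 2 * size μ + sum as * sum as + sumSquares as
    weight≡ = trans (sym sum≡) (trans (cong (λ S → 2 * sum S + (sumSquares as + sum as)) (sym β≡))
      (size-lengths μ as (trans (cong length β≡) len≡)))

  -- Agreement with the closed formula

  rest-n : rest n ≡ d + p
  rest-n = trans (cong (λ t → t + p ∸ p * n) t≡)
    (trans (cong (_∸ p * n) (+-assoc (p * n) d p)) (m+n∸m≡n (p * n) (d + p)))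

  rest-suc-n : rest (suc n) ≡ d
  rest-suc-n = trans (cong (λ t → t + p ∸ p * suc n) t≡)
    (trans (cong₂ _∸_ (lem (p * n) d p) (*-suc p n)) (m+n∸m≡n (p + p * n) d))
    where
    lem : ∀ q d p → q + d + p ≡ p + q + d
    lem = solve-∀

  tℤ : + p ℤ.* + n ℤ.+ + d ≡ + t
  tℤ = trans (cong (ℤ._+ + d) (sym (ℤ.pos-* p n))) (cong +_ (sym t≡))

  2formula≡V : ∀ m u v → u ℤ.* v ≡ + X m ℤ.* (+ X m ℤ.+ + E m) →
     + m ℤ.* (1ℤ ℤ.+ + m) ℤ.* (u ℤ.* v) ℤ.+ base (+ p ℤ.* + n ℤ.+ + d) (+ p) m ≡ V m
  2formula≡V m u v uv = cong₂ (λ w t → + m ℤ.* (1ℤ ℤ.+ + m) ℤ.* w ℤ.+ base t (+ p) m) uv tℤ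

  -- For m = n + 1 the remainder is `d`, so x and x + ε are its lower and upper halves.
  2formulaA : + 2 ℤ.* formulaA p n d ≡ V (suc n)
  2formulaA rewrite +-comm n 2 = trans
    (2formula≡ (+ p) (+ n) (+ d) (suc n) (+ (d / 2)) (+ d ℤ.- + (d / 2)))
    (2formula≡V (suc n) (+ (d / 2)) (+ d ℤ.- + (d / 2))
      (cong₂ ℤ._*_ (cong (λ k → + (k / 2)) (sym rest-suc-n)) other))
    where
    lem : ∀ e x → e ℤ.+ x ℤ.* + 2 ℤ.- x ≡ x ℤ.+ e
    lem = ℤRing.solve-∀
    other : + d ℤ.- + (d / 2) ≡ + X (suc n) ℤ.+ + E (suc n)
    other rewrite rest-suc-n = trans (cong (λ z → z ℤ.- + (d / 2))
        (trans (cong +_ (m≡m%n+[m/n]*n d 2)) (cong (λ z → + (d % 2) ℤ.+ z) (ℤ.pos-* (d / 2) 2))))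
      (lem (+ (d % 2)) (+ (d / 2)))

  -- For m = n the remainder is d + p = (p - d) + 2d, so with q the lower half of p - d one gets x =
  -- d + q and x + ε = p - q.
  2formulaB : + 2 ℤ.* formulaB p n d ≡ V n
  2formulaB rewrite +-comm n 1 = trans
    (2formula≡ (+ p) (+ n) (+ d) n (+ p ℤ.- + q) (+ d ℤ.+ + q))
    (2formula≡V n (+ p ℤ.- + q) (+ d ℤ.+ + q)
      (trans (ℤ.*-comm (+ p ℤ.- + q) (+ d ℤ.+ + q)) (cong₂ ℤ._*_ (cong +_ (sym X≡)) other)))
    where
    e = p ∸ d
    q = e / 2
    rest≡ : rest n ≡ e + d * 2
    rest≡ = trans rest-n (trans (cong (λ z → d + z) (sym (m∸n+n≡m d≤p))) (lem d e)) where
      lem : ∀ d e → d + (e + d) ≡ e + d * 2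
      lem = solve-∀
    X≡ : X n ≡ d + q
    X≡ = trans (cong (_/ 2) rest≡)
      (trans (+-distrib-/-∣ʳ e (divides d refl)) (trans (cong (λ z → q + z) (m*n/n≡m d 2)) (+-comm q d)))
    E≡ : E n ≡ e % 2
    E≡ = trans (cong (_% 2) rest≡) ([m+kn]%n≡m%n e d 2)
    lem : ∀ r q d → (r ℤ.+ q ℤ.* + 2) ℤ.+ d ℤ.- q ≡ (d ℤ.+ q) ℤ.+ r
    lem = ℤRing.solve-∀
    other : + p ℤ.- + q ≡ + X n ℤ.+ + E n
    other = trans (cong (λ z → z ℤ.- + q)
        (trans (cong +_ (trans (sym (m∸n+n≡m d≤p)) (cong (_+ d) (m≡m%n+[m/n]*n e 2))))
          (cong (λ z → (+ (e % 2) ℤ.+ z) ℤ.+ + d) (ℤ.pos-* q 2))))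
      (trans (lem (+ (e % 2)) (+ q) (+ d)) (cong₂ (λ x r → + x ℤ.+ + r) (sym X≡) (sym E≡)))

  -- The maximum and the number of maximizers

  largest : ℤ
  largest = largestSize p n d

  V≤2largest : ∀ {m} → m ≤ suc n → V m ℤ.≤ + 2 ℤ.* largest
  V≤2largest {m} m≤ = ℤ.≤-trans (V≤ m≤) (ℤ.⊔-lub step₁ step₂)
    where
    step₁ : V (suc n) ℤ.≤ + 2 ℤ.* largest
    step₁ = subst (ℤ._≤ + 2 ℤ.* largest) 2formulaA
      (ℤ.*-monoˡ-≤-nonNeg (+ 2) (ℤ.i≤i⊔j (formulaA p n d) (formulaB p n d)))
    step₂ : V n ℤ.≤ + 2 ℤ.* largest
    step₂ = subst (ℤ._≤ + 2 ℤ.* largest) 2formulaB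
      (ℤ.*-monoˡ-≤-nonNeg (+ 2) (ℤ.i≤j⊔i (formulaA p n d) (formulaB p n d)))
    V≤ : m ≤ suc n → V m ℤ.≤ V (suc n) ℤ.⊔ V n
    V≤ m≤ with <-cmp m n
    ... | tri< m<n _ _ = ℤ.≤-trans (ℤ.<⇒≤ (V-mono-< (<⇒<′ m<n) ≤-refl)) (ℤ.i≤j⊔i (V (suc n)) (V n))
    ... | tri≈ _ refl _ = ℤ.i≤j⊔i (V (suc n)) (V n)
    ... | tri> _ _ n<m = subst (λ k → V k ℤ.≤ V (suc n) ℤ.⊔ V n) (≤-antisym n<m m≤) (ℤ.i≤i⊔j (V (suc n)) (V n))

  size≤largest : ∀ μ → IsMultiCore t p μ → + size μ ℤ.≤ largest
  size≤largest μ core = let m , m≤ , 2size≤ , _ = core⇒bounded core in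
    ℤ.*-cancelˡ-≤-pos (+ size μ) largest (+ 2) (ℤ.≤-trans 2size≤ (V≤2largest m≤))

  attains : ∀ {m} f → m ≤ suc n → + 2 ℤ.* f ≡ V m → largest ≡ f →
    ∃[ μ ] (IsMultiCore t p μ × + size μ ≡ largest)
  attains f m≤ 2f≡V largest≡ = let μ , core , 2size≡V = attained m≤ in
    μ , core , trans (ℤ.*-cancelˡ-≡ (+ 2) (+ size μ) f (trans 2size≡V (sym 2f≡V))) (sym largest≡)

  largest-attained : ∃[ μ ] (IsMultiCore t p μ × + size μ ≡ largest)
  largest-attained =
    [ attains (formulaA p n d) ≤-refl 2formulaA , attains (formulaB p n d) (n≤1+n n) 2formulaB ]′
    (ℤ.⊔-sel (formulaA p n d) (formulaB p n d))

  extremes : List (List ℕ)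
  extremes = blocks (arithmetic (X n + 0) p n) ∷ blocks (arithmetic (X n + E n) p n)
    ∷ blocks (arithmetic (X (suc n) + 0) p (suc n)) ∷ blocks (arithmetic (X (suc n) + E (suc n)) p (suc n)) ∷ []

  -- For m < n already `V n`, which is at most twice the maximum, exceeds `V m`.
  near-top : ∀ {m} → m ≤ suc n → + 2 ℤ.* largest ℤ.≤ V m → m ≡ n ⊎ m ≡ suc n
  near-top m≤ ≤V = [ (λ m<1+n → [ (λ m<n → contradiction ≤V
        (ℤ.<⇒≱ (ℤ.<-≤-trans (V-mono-< (<⇒<′ m<n) ≤-refl) (V≤2largest (n≤1+n n))))) , inj₁ ]′
      (m≤n⇒m<n∨m≡n (s≤s⁻¹ m<1+n))) , inj₂ ]′ (m≤n⇒m<n∨m≡n m≤)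

  extreme∈ : ∀ {m S} → m ≡ n ⊎ m ≡ suc n → Extreme m S → S ∈ extremes
  extreme∈ (inj₁ refl) (inj₁ eq) = here eq
  extreme∈ (inj₁ refl) (inj₂ eq) = there (here eq)
  extreme∈ (inj₂ refl) (inj₁ eq) = there (there (here eq))
  extreme∈ (inj₂ refl) (inj₂ eq) = there (there (there (here eq)))

  largest⇒extreme : ∀ {μ} → IsMultiCore t p μ → + size μ ≡ largest → beta μ ∈ extremes
  largest⇒extreme {μ} core size≡ = let m , m≤ , 2size≤ , extreme = core⇒bounded core in
    extreme∈ (near-top m≤ (subst (λ s → + 2 ℤ.* s ℤ.≤ V m) size≡ 2size≤))
      (extreme (subst (λ s → V m ℤ.≤ + 2 ℤ.* s) (sym size≡) (V≤2largest m≤)))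

  -- `beta` maps the maximizers injectively into the four entries of `extremes`; repetitions among
  -- these only lower the count.
  length-maximizers≤4 : ∀ (μs : List (List ℕ)) → Unique μs →
    All (λ μ → IsMultiCore t p μ × + size μ ≡ largest) μs → length μs ≤ 4
  length-maximizers≤4 μs unique maximal = subst (_≤ 4) (length-map beta μs)
    (unique-⊆⇒length≤ (Unique.map⁺ beta-injective unique) sub)
    where
    sub : ∀ {S} → S ∈ map beta μs → S ∈ extremes
    sub S∈ with ∈-map⁻ beta S∈
    ... | μ , μ∈ , refl = let core , size≡ = All.lookup maximal μ∈ in largest⇒extreme core size≡

theorem1p1 : (t p n d : ℕ) → 1 ≤ t → 1 ≤ p → t ≡ p * n + d → 1 ≤ d → d ≤ p →
    (∃[ μ ] (IsMultiCore t p μ × + size μ ≡ largestSize p n d))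
    × (∀ μ → IsMultiCore t p μ → Data.Integer._≤_ (+ size μ) (largestSize p n d))
    × (∀ (μs : List (List ℕ)) → Unique μs
         → All (λ μ → IsMultiCore t p μ × + size μ ≡ largestSize p n d) μs
         → length μs ≤ 4)
theorem1p1 t p n d 1≤t 1≤p t≡ 1≤d d≤p = largest-attained , size≤largest , length-maximizers≤4
  where open Extremal t p n d 1≤t 1≤p t≡ 1≤d d≤p
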